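{- Let $\mathcal{A}$ be an integral affinographic hyperplane arrangement in $\mathbb{R}^n$ and let $m\in\mathbb Z$ be nonnegative. The number of integer points in $[m]^n$ that are contained in none of the hyperplanes of $\mathcal{A}$ equals $\chi^{\mathbb Z}_{\Phi(\mathcal A)}(m)$, the number of proper integral $m$-colorations of the integral gain graph $\Phi=\Phi(\mathcal A)$, and hence equals $$\sum_{B\in\operatorname{Lat}^{\mathrm b}\Phi}\mu(\varnothing,B)\prod_{W\in\pi(B)}\big[m-h_B(W)\big]^+ ,$$ where $\mu$ is the M\"obius function of $\operatorname{Lat}^{\mathrm b}\Phi$.
   Context: An integral affinographic hyperplane arrangement in $\mathbb R^n$ is a finite set $\mathcal A$ of affine hyperplanes of the form $h_{ij}(g): x_j-x_i=g$ with $i,j\in[n]$, $i\neq j$, $g\in\mathbb Z$. Here $[m]=\{1,\dots,m\}$, $[0]=\varnothing$. An integral gain graph consists of a graph $(V,E)$ (loops and multiple edges allowed) and a gain function $\varphi$ assigning an integer to each oriented edge, with $\varphi(e^{ -1})=-\varphi(e)$ when $e^{ -1}$ is $e$ with the opposite orientation. The notation $g e_{ij}$ means an edge with endpoints $v_i,v_j$ whose gain in the direction from $v_i$ to $v_j$ is $g$. The integral gain graph $\Phi(\mathcal A)$ has vertex set $V=\{v_1,\dots,v_n\}$ and one edge $g e_{ij}$ for each hyperplane $h_{ij}(g)\in\mathcal A$ (the hyperplanes $h_{ij}(g)$ and $h_{ji}(-g)$ coincide and give the same edge). An integral $m$-coloration is a function $x:V\to[m]$, $v_i\mapsto x_i$;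 it is proper if $x_j\ne x_i+g$ for every edge $g e_{ij}$. The gain of a path or circle is the sum of the gains of its edges, all oriented in the direction of traversal. A circle is a connected subgraph that is regular of degree 2, or its edge set. An edge set is balanced if every circle contained in it has gain $0$. A balanced edge set $B$ is closed if it contains every edge $g e_{ij}$ of $\Phi$ such that $B$ contains a path from $v_i$ to $v_j$ with gain $g$. $\operatorname{Lat}^{\mathrm b}\Phi$ is the set of all closed, balanced edge sets, ordered by inclusion. For a balanced set $B$, $\pi(B)$ is the partition of $V$ into the vertex sets of the connected components of $(V,B)$. For $W\in\pi(B)$, the height $h_B(W)$ is the maximum gain of a path (in either direction, length $0$ with gain $0$ allowed) in the component of $(V,B)$ with vertex set $W$. For real $r$, $r^+=\max(r,0)$. -}

module Defs where

open import Data.Bool.Base using (true; false)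
open import Data.Fin.Base using (Fin; toℕ)
import Data.Fin.Properties as Fin
open import Data.Fin.Subset as Sub using (Subset; _∈_; _⊆_; _⊂_; Nonempty)
open import Data.Fin.Subset.Induction using (⊂-wellFounded)
open import Data.Fin.Subset.Properties as Sub
  using (_∈?_; _⊆?_; _⊂?_; nonempty?; anySubset?)
open import Data.Integer.Base as ℤ using (ℤ; +_; 0ℤ; 1ℤ; _⊔_)
import Data.Integer.Properties as ℤ
open import Data.List.Base as List
  using (List; []; _∷_; map; concatMap; filter; foldr; length; allFin; upTo;
         cartesianProduct; cartesianProductWith; deduplicate)
import Data.List.Membership.Propositional as L
open import Data.List.Membership.Propositional.Properties
  using (∈-allFin; ∈-upTo⁺; ∈-cartesianProduct⁺; ∈-cartesianProductWith⁺;
         ∈-concatMap⁺; ∈-map⁺; ∈-lookup)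
open import Data.List.Properties using (length-map)
open import Data.List.Relation.Unary.All as All using (All; []; _∷_; all?)
open import Data.List.Relation.Unary.AllPairs using ([]; _∷_)
open import Data.List.Relation.Unary.Any as Any using (any?; here; there)
open import Data.List.Relation.Unary.Unique.Propositional using (Unique)
import Data.List.Relation.Unary.Unique.DecPropositional as DecUnique
import Data.List.Membership.DecPropositional as DecMembership
open import Data.Nat.Base as ℕ using (ℕ; zero; suc; s≤s)
import Data.Nat.Properties as ℕ
open import Data.Product.Base using (Σ; ∃; _×_; _,_; proj₁; proj₂; uncurry)
open import Data.Sign.Base using (Sign)
open import Data.Vec.Base as Vec using (Vec; []; _∷_; lookup)
import Data.Vec.Properties as Vec
import Data.Bool.Properties as Bool
open import Function.Base using (_∘_)
open import Function.Bundles using (_⇔_; mk⇔; Equivalence)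
open import Induction.WellFounded using (Acc; acc)
open import Relation.Binary.Definitions using (DecidableEquality)
open import Relation.Binary.PropositionalEquality
  using (_≡_; _≢_; refl; sym; trans; cong; subst)
open import Relation.Nullary
  using (Dec; yes; no; does; ¬_; ¬?; _×-dec_; _→-dec_; contradiction)
open import Relation.Nullary.Decidable as Dec using (map′; decidable-stable)
open import Relation.Unary using (Decidable)

private
  variable
    A : Set
    k l n : ℕ

------------------------------------------------------------------------
-- Finite enumerations and sums

vectors : List A → (n : ℕ) → List (Vec A n)
vectors xs zero    = [] ∷ []
vectors xs (suc n) = cartesianProductWith _∷_ xs (vectors xs n)

listsUpTo : List A → ℕ → List (List A)
listsUpTo xs l = concatMap (λ k → map Vec.toList (vectors xs k)) (upTo (suc l))

subsets : (k : ℕ) → List (Subset k)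
subsets = vectors (Sub.inside ∷ Sub.outside ∷ [])

∑ ∏ : List A → (A → ℤ) → ℤ
∑ xs f = foldr ℤ._+_ 0ℤ (map f xs)
∏ xs f = foldr ℤ._*_ 1ℤ (map f xs)

infix 5 ∑ ∏
syntax ∑ xs (λ x → e) = ∑[ x ∈ xs ] e
syntax ∏ xs (λ x → e) = ∏[ x ∈ xs ] e

infix 8 _⁺
_⁺ : ℤ → ℤ
r ⁺ = r ⊔ 0ℤ

_≟ₛ_ : DecidableEquality (Subset k)
_≟ₛ_ = Vec.≡-dec Bool._≟_

∈-vectors : {xs : List A} → (∀ x → x L.∈ xs) → (v : Vec A n) → v L.∈ vectors xs n
∈-vectors all []      = here refl
∈-vectors all (x ∷ v) = ∈-cartesianProductWith⁺ _∷_ (all x) (∈-vectors all v)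

∈-listsUpTo : {xs : List A} → (∀ x → x L.∈ xs) →
              (ys : List A) → length ys ℕ.≤ l → ys L.∈ listsUpTo xs l
∈-listsUpTo {xs = xs} all ys len≤l =
  ∈-concatMap⁺ (λ k → map Vec.toList (vectors xs k))
    (Any.map (λ { refl → lemma ys }) (∈-upTo⁺ (s≤s len≤l)))
  where
  lemma : ∀ zs → zs L.∈ map Vec.toList (vectors xs (length zs))
  lemma zs = subst (L._∈ map Vec.toList (vectors xs (length zs)))
                   (Vec.toList∘fromList zs)
                   (∈-map⁺ Vec.toList (∈-vectors all (Vec.fromList zs)))

unique⇒length≤ : (xs : List (Fin n)) → Unique xs → length xs ℕ.≤ n
unique⇒length≤ xs u = Fin.injective⇒≤ (lookup-inj xs u)
  where
  lookup-inj : (xs : List (Fin n)) → Unique xs →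
               ∀ {i j} → List.lookup xs i ≡ List.lookup xs j → i ≡ j
  lookup-inj (x ∷ xs) (x∉ ∷ u) {Fin.zero}  {Fin.zero}  eq = refl
  lookup-inj (x ∷ xs) (x∉ ∷ u) {Fin.zero}  {Fin.suc j} eq =
    contradiction eq (All.lookup x∉ (∈-lookup j))
  lookup-inj (x ∷ xs) (x∉ ∷ u) {Fin.suc i} {Fin.zero}  eq =
    contradiction (sym eq) (All.lookup x∉ (∈-lookup i))
  lookup-inj (x ∷ xs) (x∉ ∷ u) {Fin.suc i} {Fin.suc j} eq =
    cong Fin.suc (lookup-inj xs u eq)

allSubsets? : {P : Subset k → Set} → Decidable P → Dec (∀ S → P S)
allSubsets? P? = map′
  (λ ∄ S → decidable-stable (P? S) (λ ¬p → ∄ (S , ¬p)))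
  (λ ∀p (S , ¬p) → ¬p (∀p S))
  (¬? (anySubset? (λ S → ¬? (P? S))))

------------------------------------------------------------------------
-- Affinographic arrangements

-- The hyperplane h i j g : x j - x i = g.  It is treated through its integer
-- points; since g is an integer these determine the hyperplane.
record Hyperplane (n : ℕ) : Set where
  field
    i j : Fin n
    i≢j : i ≢ j
    g   : ℤ

infix 4 _∈ₕ_ _∈ₕ?_

_∈ₕ_ : Vec ℤ n → Hyperplane n → Set
x ∈ₕ h = lookup x j ℤ.- lookup x i ≡ g
  where open Hyperplane h

_∈ₕ?_ : (x : Vec ℤ n) (h : Hyperplane n) → Dec (x ∈ₕ h)
x ∈ₕ? h = _ ℤ.≟ _

-- A finite set of hyperplanes: h i j g and h j i (- g) are the same point
-- set, so at most one of them is listed.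
record Arrangement (n : ℕ) : Set where
  field
    size       : ℕ
    hyperplane : Fin size → Hyperplane n
    distinct   : ∀ p q → (∀ x → x ∈ₕ hyperplane p ⇔ x ∈ₕ hyperplane q) → p ≡ q

module _ (𝒜 : Arrangement n) where
  open Arrangement 𝒜

  Avoids : Vec ℤ n → Set
  Avoids x = ∀ p → ¬ x ∈ₕ hyperplane p

  avoids? : Decidable Avoids
  avoids? x = Fin.all? (λ p → ¬? (x ∈ₕ? hyperplane p))

  avoidingPoints : ℕ → ℕ
  avoidingPoints m =
    length (filter avoids? (vectors (map (λ c → + suc c) (upTo m)) n))

------------------------------------------------------------------------
-- Integral gain graphs

-- Loops and multiple edges are allowed.  Each edge is stored with a reference
-- orientation from src to tgt; gain is its gain in that orientation.
record GainGraph (n : ℕ) : Set where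
  field
    size    : ℕ
    src tgt : Fin size → Fin n
    gain    : Fin size → ℤ

Φ : Arrangement n → GainGraph n
Φ 𝒜 = record
  { size = size
  ; src  = Hyperplane.i ∘ hyperplane
  ; tgt  = Hyperplane.j ∘ hyperplane
  ; gain = Hyperplane.g ∘ hyperplane
  } where open Arrangement 𝒜

module _ (G : GainGraph n) where
  open GainGraph G

  EdgeSet : Set
  EdgeSet = Subset size

  -- An oriented edge; Sign.- reverses the reference orientation.
  Dart : Set
  Dart = Fin size × Sign

  edge : Dart → Fin size
  edge = proj₁

  tail head : Dart → Fin n
  tail (e , Sign.+) = src e
  tail (e , Sign.-) = tgt e
  head (e , Sign.+) = tgt e
  head (e , Sign.-) = src e

  φ : Dart → ℤ
  φ (e , Sign.+) = gain e
  φ (e , Sign.-) = ℤ.- gain e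

  darts : List Dart
  darts = cartesianProduct (allFin size) (Sign.+ ∷ Sign.- ∷ [])

  ∈-darts : ∀ d → d L.∈ darts
  ∈-darts (e , Sign.+) = ∈-cartesianProduct⁺ (∈-allFin e) (here refl)
  ∈-darts (e , Sign.-) = ∈-cartesianProduct⁺ (∈-allFin e) (there (here refl))

  allDarts? : {P : Dart → Set} → Decidable P → Dec (∀ d → P d)
  allDarts? P? = map′ (λ ps d → All.lookup ps (∈-darts d)) (λ ∀p → All.universal ∀p _)
                      (all? P? darts)

  ----------------------------------------------------------------------
  -- Colorations

  -- The colour set [m] is {1 , … , m}.
  colour : ∀ {m} → Vec (Fin m) n → Fin n → ℤ
  colour x v = + suc (toℕ (lookup x v))

  Proper : ∀ {m} → Vec (Fin m) n → Set
  Proper x = ∀ d → colour x (head d) ≢ colour x (tail d) ℤ.+ φ d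

  proper? : ∀ {m} → Decidable (Proper {m})
  proper? x = allDarts? (λ d → ¬? (_ ℤ.≟ _))

  χℤ : ℕ → ℕ
  χℤ m = length (filter proper? (vectors (allFin m) n))

  ----------------------------------------------------------------------
  -- Walks and paths

  IsWalk : Fin n → List Dart → Fin n → Set
  IsWalk u []       v = u ≡ v
  IsWalk u (d ∷ ds) v = u ≡ tail d × IsWalk (head d) ds v

  vertices : Fin n → List Dart → List (Fin n)
  vertices u ds = u ∷ map head ds

  totalGain : List Dart → ℤ
  totalGain ds = ∑ ds φ

  IsPath : EdgeSet → Fin n → List Dart → Fin n → Set
  IsPath B u ds v =
    IsWalk u ds v × All ((_∈ B) ∘ edge) ds × Unique (vertices u ds)

  Joined : EdgeSet → Fin n → Fin n → Set
  Joined B u v = ∃ λ ds → IsPath B u ds v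

  isWalk? : ∀ u ds v → Dec (IsWalk u ds v)
  isWalk? u []       v = u Fin.≟ v
  isWalk? u (d ∷ ds) v = (u Fin.≟ tail d) ×-dec isWalk? (head d) ds v

  isPath? : ∀ B u ds v → Dec (IsPath B u ds v)
  isPath? B u ds v = isWalk? u ds v
    ×-dec all? (λ d → edge d ∈? B) ds
    ×-dec DecUnique.unique? Fin._≟_ (vertices u ds)

  path-length≤ : ∀ B u ds v → IsPath B u ds v → length ds ℕ.≤ n
  path-length≤ B u ds v (_ , _ , uniq) = ℕ.≤-trans (ℕ.n≤1+n _)
    (subst (λ l → suc l ℕ.≤ n) (length-map head ds)
           (unique⇒length≤ (vertices u ds) uniq))

  boundedAll? : ∀ {P Q : List Dart → Set} l → Decidable P → Decidable Q →
                (∀ ds → P ds → length ds ℕ.≤ l) → Dec (∀ ds → P ds → Q ds)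
  boundedAll? l P? Q? bound = map′
    (λ ps ds p → All.lookup ps (∈-listsUpTo ∈-darts ds (bound ds p)) p)
    (λ ∀p → All.universal ∀p _)
    (all? (λ ds → P? ds →-dec Q? ds) (listsUpTo darts l))

  boundedAny? : ∀ {P : List Dart → Set} l → Decidable P →
                (∀ ds → P ds → length ds ℕ.≤ l) → Dec (∃ P)
  boundedAny? l P? bound = map′
    Any.satisfied
    (λ (ds , p) → L.lose (∈-listsUpTo ∈-darts ds (bound ds p)) p)
    (any? P? (listsUpTo darts l))

  joined? : ∀ B u v → Dec (Joined B u v)
  joined? B u v =
    boundedAny? n (λ ds → isPath? B u ds v) (λ ds → path-length≤ B u ds v)

  ----------------------------------------------------------------------
  -- Circles

  -- A loop has two darts with the same tail, so it contributes 2.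
  degree : EdgeSet → Fin n → ℕ
  degree C v = length (filter (λ d → (edge d ∈? C) ×-dec (tail d Fin.≟ v)) darts)

  -- The subgraph with vertex set X and edge set C is a circle.
  record IsCircle (X : Subset n) (C : EdgeSet) : Set where
    field
      nonempty  : Nonempty X
      subgraph  : ∀ d → edge d ∈ C → tail d ∈ X
      regular   : ∀ v → v ∈ X → degree C v ≡ 2
      connected : ∀ u v → u ∈ X → v ∈ X → Joined C u v

  -- A traversal of C from v: a closed walk using each edge of C exactly once
  -- and no other edge.
  Traverses : EdgeSet → Fin n → List Dart → Set
  Traverses C v ds =
    IsWalk v ds v × Unique (map edge ds) × (∀ e → e ∈ C ⇔ e L.∈ map edge ds)

  Balanced : EdgeSet → Set
  Balanced B = ∀ X C → IsCircle X C → C ⊆ B →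
               ∀ v ds → Traverses C v ds → totalGain ds ≡ 0ℤ

  isCircle? : ∀ X C → Dec (IsCircle X C)
  isCircle? X C = map′
    (λ (a , b , c , d) → record
      { nonempty = a ; subgraph = b ; regular = c ; connected = d })
    (λ c → let open IsCircle c in nonempty , subgraph , regular , connected)
    (nonempty? X
      ×-dec allDarts? (λ d → (edge d ∈? C) →-dec (tail d ∈? X))
      ×-dec Fin.all? (λ v → (v ∈? X) →-dec (degree C v ℕ.≟ 2))
      ×-dec Fin.all? (λ u → Fin.all? (λ v →
              (u ∈? X) →-dec ((v ∈? X) →-dec joined? C u v))))

  traverses? : ∀ C v ds → Dec (Traverses C v ds)
  traverses? C v ds = isWalk? v ds v
    ×-dec DecUnique.unique? Fin._≟_ (map edge ds)
    ×-dec Fin.all? (λ e → map′ (uncurry mk⇔)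
            (λ eq → Equivalence.to eq , Equivalence.from eq)
            (((e ∈? C) →-dec (e ∈ₗ? map edge ds))
              ×-dec ((e ∈ₗ? map edge ds) →-dec (e ∈? C))))
    where open DecMembership (Fin._≟_ {size}) using () renaming (_∈?_ to _∈ₗ?_)

  balanced? : Decidable Balanced
  balanced? B = allSubsets? λ X → allSubsets? λ C →
    isCircle? X C →-dec ((C ⊆? B) →-dec Fin.all? λ v →
      boundedAll? size (traverses? C v) (λ ds → totalGain ds ℤ.≟ 0ℤ)
        (λ ds (_ , uniq , _) → subst (ℕ._≤ size) (length-map edge ds)
                                     (unique⇒length≤ (map edge ds) uniq)))

  ----------------------------------------------------------------------
  -- The semilattice of closed, balanced edge sets

  Closed : EdgeSet → Set
  Closed B = ∀ d ds → IsPath B (tail d) ds (head d) → totalGain ds ≡ φ d → edge d ∈ B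

  closed? : Decidable Closed
  closed? B = allDarts? λ d → boundedAll? n
    (λ ds → isPath? B (tail d) ds (head d))
    (λ ds → (totalGain ds ℤ.≟ φ d) →-dec (edge d ∈? B))
    (λ ds → path-length≤ B (tail d) ds (head d))

  Latᵇ : List EdgeSet
  Latᵇ = filter (λ B → balanced? B ×-dec closed? B) (subsets size)

  -- μ(S,T) = 1 if S = T, and otherwise minus the sum of μ(S,R) over all R
  -- in Latᵇ with S ⊆ R ⊂ T.
  μ-acc : (S T : EdgeSet) → Acc _⊂_ T → ℤ
  μ-acc S T (acc rec) with S ≟ₛ T
  ... | yes _ = 1ℤ
  ... | no  _ = ℤ.- (∑[ R ∈ Latᵇ ] term R)
    where
    term : EdgeSet → ℤ
    term R with S ⊆? R | R ⊂? T
    ... | yes _ | yes R⊂T = μ-acc S R (rec R⊂T)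
    ... | _     | _       = 0ℤ

  μ : EdgeSet → EdgeSet → ℤ
  μ S T = μ-acc S T (⊂-wellFounded T)

  ----------------------------------------------------------------------
  -- Components and heights

  component : EdgeSet → Fin n → Subset n
  component B u = Vec.tabulate (λ v → does (joined? B u v))

  π : EdgeSet → List (Subset n)
  π B = deduplicate _≟ₛ_ (map (component B) (allFin n))

  -- The gains of all paths with edges in B and vertices in W.
  pathGains : EdgeSet → Subset n → List ℤ
  pathGains B W = map (λ (_ , ds , _) → totalGain ds) (filter
    (λ (u , ds , v) → isPath? B u ds v ×-dec all? (_∈? W) (vertices u ds))
    (cartesianProduct (allFin n)
      (cartesianProduct (listsUpTo darts n) (allFin n))))

  -- Paths of length 0 have gain 0, so starting the maximum at 0 is harmless.
  height : EdgeSet → Subset n → ℤ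
  height B W = foldr _⊔_ 0ℤ (pathGains B W)

{-# OPTIONS --safe #-}

-- For an integer point x let I(x) be the set of edges whose hyperplane contains
-- x; it is closed and balanced, and x avoids the arrangement iff I(x) = ⊥.
-- Since ∑_{B ⊆ I(x)} μ(⊥,B) = [I(x) = ⊥], exchanging summations gives
-- ∑_B μ(⊥,B) #{x : B ⊆ I(x)}.  When B is balanced, the condition B ⊆ I(x)
-- determines x on each component W from its value at one vertex; the gains along
-- W spread the values over an interval of length h(W), which leaves (m - h(W))⁺
-- choices.  The count over all components fixes the coordinates one at a time:
-- the first vertex of each component is free, the others are forced.

module Submission where

open import Defs

open import Data.Bool.Base using (true; false)
open import Data.Fin.Base as Fin using (Fin; toℕ)
import Data.Fin.Properties as Fin
open import Data.Fin.Subset using (Subset; ⊥; _∈_; _⊆_; _⊂_)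
open import Data.Fin.Subset.Induction using (⊂-wellFounded)
open import Data.Fin.Subset.Properties as Sub using (_∈?_; _⊆?_; _⊂?_)
open import Data.Integer.Base as ℤ using (ℤ; +_; 0ℤ; 1ℤ; _+_; _*_; _-_; -_; _⊔_)
import Data.Integer.Properties as ℤ
open import Algebra.Properties.AbelianGroup ℤ.+-0-abelianGroup using (identityʳ-unique)
import Data.Integer.Tactic.RingSolver as ℤ-Solver
open import Data.List.Base as List
  using (List; []; _∷_; [_]; _++_; map; filter; foldr; length; allFin; upTo; deduplicate;
         cartesianProductWith; cartesianProduct)
import Data.List.Membership.Propositional as L
open import Data.List.Membership.Propositional.Properties
open import Data.List.Membership.Propositional.Properties.WithK using (unique∧set⇒bag)
import Data.List.Membership.DecPropositional as DecMembership
import Data.List.Properties as List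
open import Data.List.Relation.Binary.BagAndSetEquality using (∼bag⇒↭)
open import Data.List.Relation.Binary.Permutation.Propositional.Properties using (↭-length)
open import Data.List.Relation.Unary.All as All using (All; []; _∷_)
import Data.List.Relation.Unary.All.Properties as All
open import Data.List.Relation.Unary.AllPairs using ([]; _∷_)
open import Data.List.Relation.Unary.Any as Any using (here; there)
open import Data.List.Relation.Unary.Unique.Propositional using (Unique)
import Data.List.Relation.Unary.Unique.Propositional.Properties as Unique
open import Data.Nat.Base as ℕ using (ℕ; zero; suc; _∸_; z≤n; s≤s)
import Data.Nat.Properties as ℕ
open import Data.Product.Base using (∃; ∃₂; _×_; _,_; proj₁; proj₂)
open import Data.Sign.Base using (Sign; opposite)
open import Data.Sum.Base using (_⊎_; inj₁; inj₂; [_,_]′)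
open import Data.Vec.Base as Vec using (Vec; []; _∷_; lookup)
import Data.Vec.Properties as Vec
open import Function.Base using (_∘_; id)
open import Function.Bundles using (_⇔_; mk⇔; Equivalence)
open import Induction.WellFounded using (Acc; acc)
open import Relation.Binary.Definitions using (DecidableEquality; tri<; tri≈; tri>)
open import Relation.Binary.PropositionalEquality
  using (_≡_; _≢_; refl; sym; trans; cong; cong₂; subst; module ≡-Reasoning)
open import Relation.Nullary
  using (Dec; yes; no; does; ¬_; ¬?; _×-dec_; _→-dec_; contradiction)
open import Relation.Unary using (Decidable)

open Equivalence using (to; from)

private
  variable
    A A′ : Set
    P Q : Set
    m n : ℕ

-- Balance is defined through circles, whereas the count needs gains that depend only on the
-- endpoints of a walk. The bridge is loop erasure: prepending an edge to a path either gives a path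
-- again or closes off an initial segment. The closed part is a circle or the edge run back along
-- itself, and has gain 0 in both cases. Hence the gain between joined vertices is well defined and
-- additive.
--
-- Coordinates are fixed in index order, without splitting the vertex set into components. The
-- obstacle is that a colour chosen at the first vertex of a component may push a later vertex out
-- of `[m]`, so the number of continuations would depend on the choice. The constraint at each
-- vertex therefore asks in advance that its whole component stay in range; a forced vertex then has
-- exactly one continuation, and the count is a product over vertices with factor 1 at the forced
-- ones.
--
-- `μ` is defined by recursion on accessibility proofs, so its recursion formula becomes usable only
-- once the value is known not to depend on the proof.

-- Indicators, finite sums and products

𝟙 : Dec P → ℤ
𝟙 (yes _) = 1ℤ
𝟙 (no _)  = 0ℤ

𝟙-cong : (P? : Dec P) (Q? : Dec Q) → (P → Q) → (Q → P) → 𝟙 P? ≡ 𝟙 Q?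
𝟙-cong (yes _) (yes _) _ _ = refl
𝟙-cong (yes p) (no ¬q) f _ = contradiction (f p) ¬q
𝟙-cong (no ¬p) (yes q) _ g = contradiction (g q) ¬p
𝟙-cong (no _)  (no _)  _ _ = refl

𝟙-yes : (P? : Dec P) → P → 𝟙 P? ≡ 1ℤ
𝟙-yes (yes _) _ = refl
𝟙-yes (no ¬p) p = contradiction p ¬p

𝟙-no : (P? : Dec P) → ¬ P → 𝟙 P? ≡ 0ℤ
𝟙-no (yes p) ¬p = contradiction p ¬p
𝟙-no (no _)  _  = refl

∑-cong : ∀ (xs : List A) {f g : A → ℤ} → (∀ x → x L.∈ xs → f x ≡ g x) → ∑ xs f ≡ ∑ xs g
∑-cong []       f≡g = refl
∑-cong (x ∷ xs) f≡g =
  cong₂ _+_ (f≡g x (here refl)) (∑-cong xs (λ y y∈xs → f≡g y (there y∈xs)))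

∑-zero : ∀ (xs : List A) → ∑ xs (λ _ → 0ℤ) ≡ 0ℤ
∑-zero []       = refl
∑-zero (x ∷ xs) = trans (ℤ.+-identityˡ (∑ xs (λ _ → 0ℤ))) (∑-zero xs)

∑-+ : ∀ (xs : List A) (f g : A → ℤ) → ∑ xs (λ x → f x + g x) ≡ ∑ xs f + ∑ xs g
∑-+ []       f g = refl
∑-+ (x ∷ xs) f g = trans (cong (ℤ._+_ (f x + g x)) (∑-+ xs f g))
  (interchange (f x) (g x) (∑ xs f) (∑ xs g))
  where
  interchange : ∀ a b c d → a + b + (c + d) ≡ a + c + (b + d)
  interchange = ℤ-Solver.solve-∀

∑-*ˡ : ∀ (xs : List A) a (f : A → ℤ) → ∑ xs (λ x → a * f x) ≡ a * ∑ xs f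
∑-*ˡ []       a f = sym (ℤ.*-zeroʳ a)
∑-*ˡ (x ∷ xs) a f = trans (cong (ℤ._+_ (a * f x)) (∑-*ˡ xs a f))
  (sym (ℤ.*-distribˡ-+ a (f x) (∑ xs f)))

∑-swap : ∀ (xs : List A) (ys : List A′) (f : A → A′ → ℤ) →
         ∑ xs (λ x → ∑ ys (f x)) ≡ ∑ ys (λ y → ∑ xs (λ x → f x y))
∑-swap []       ys f = sym (∑-zero ys)
∑-swap (x ∷ xs) ys f = trans (cong (ℤ._+_ (∑ ys (f x))) (∑-swap xs ys f))
  (sym (∑-+ ys (f x) (λ y → ∑ xs (λ x → f x y))))

∑-++ : ∀ (xs ys : List A) f → ∑ (xs ++ ys) f ≡ ∑ xs f + ∑ ys f
∑-++ []       ys f = sym (ℤ.+-identityˡ _)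
∑-++ (x ∷ xs) ys f = trans (cong (ℤ._+_ (f x)) (∑-++ xs ys f))
  (sym (ℤ.+-assoc (f x) (∑ xs f) (∑ ys f)))

∑-map : ∀ (g : A → A′) xs f → ∑ (map g xs) f ≡ ∑ xs (f ∘ g)
∑-map g xs f = cong (foldr _+_ 0ℤ) (sym (List.map-∘ xs))

∏-cong : ∀ (xs : List A) {f g : A → ℤ} → (∀ x → f x ≡ g x) → ∏ xs f ≡ ∏ xs g
∏-cong xs f≡g = cong (foldr _*_ 1ℤ) (List.map-cong f≡g xs)

∏-map : ∀ (g : A → A′) xs f → ∏ (map g xs) f ≡ ∏ xs (f ∘ g)
∏-map g xs f = cong (foldr _*_ 1ℤ) (sym (List.map-∘ xs))

∏-allFin-suc : ∀ n (f : Fin (suc n) → ℤ) →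
               ∏ (allFin (suc n)) f ≡ f Fin.zero * ∏ (allFin n) (f ∘ Fin.suc)
∏-allFin-suc n f = cong (f Fin.zero *_) (trans
  (cong (λ is → ∏ is f) (sym (List.map-tabulate id Fin.suc)))
  (∏-map Fin.suc (allFin n) f))

length-filter≡∑ : {R : A → Set} (R? : Decidable R) (xs : List A) →
                  + length (filter R? xs) ≡ ∑[ x ∈ xs ] 𝟙 (R? x)
length-filter≡∑ R? []       = refl
length-filter≡∑ R? (x ∷ xs) with R? x
... | yes _ = cong (ℤ._+_ 1ℤ) (length-filter≡∑ R? xs)
... | no  _ = trans (length-filter≡∑ R? xs) (sym (ℤ.+-identityˡ _))

∑-𝟙≡ : (_≟_ : DecidableEquality A) (xs : List A) → Unique xs → ∀ y → y L.∈ xs →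
       (f : A → ℤ) → ∑ xs (λ x → f x * 𝟙 (x ≟ y)) ≡ f y
∑-𝟙≡ _≟_ (x ∷ xs) (x∉ ∷ u) .x (here refl) f = begin
  f x * 𝟙 (x ≟ x) + ∑ xs (λ z → f z * 𝟙 (z ≟ x))
    ≡⟨ cong₂ _+_ (cong (f x *_) (𝟙-yes (x ≟ x) refl)) (∑-cong xs λ z z∈ →
         trans (cong (f z *_) (𝟙-no (z ≟ x) (All.lookup x∉ z∈ ∘ sym))) (ℤ.*-zeroʳ (f z))) ⟩
  f x * 1ℤ + ∑ xs (λ _ → 0ℤ)
    ≡⟨ cong₂ _+_ (ℤ.*-identityʳ (f x)) (∑-zero xs) ⟩
  f x + 0ℤ
    ≡⟨ ℤ.+-identityʳ (f x) ⟩
  f x ∎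
  where open ≡-Reasoning
∑-𝟙≡ _≟_ (x ∷ xs) (x∉ ∷ u) y (there y∈) f = begin
  f x * 𝟙 (x ≟ y) + ∑ xs (λ z → f z * 𝟙 (z ≟ y))
    ≡⟨ cong₂ _+_ (cong (f x *_) (𝟙-no (x ≟ y) (All.lookup x∉ y∈))) (∑-𝟙≡ _≟_ xs u y y∈ f) ⟩
  f x * 0ℤ + f y
    ≡⟨ cong (_+ f y) (ℤ.*-zeroʳ (f x)) ⟩
  0ℤ + f y
    ≡⟨ ℤ.+-identityˡ (f y) ⟩
  f y ∎
  where open ≡-Reasoning

-- Enumerations of vectors and subsets

∈-vectors⁻ : ∀ {xs : List A} n {v} → v L.∈ vectors xs n → ∀ i → lookup v i L.∈ xs
∈-vectors⁻ {xs = xs} (suc n) v∈ i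
  with _ , _ , a∈ , w∈ , refl ← ∈-cartesianProductWith⁻ _∷_ xs (vectors xs n) v∈ | i
... | Fin.zero  = a∈
... | Fin.suc j = ∈-vectors⁻ n w∈ j

vectors-unique : ∀ {xs : List A} n → Unique xs → Unique (vectors xs n)
vectors-unique zero    u = [] ∷ []
vectors-unique (suc n) u =
  Unique.cartesianProductWith⁺ _∷_ Vec.∷-injective u (vectors-unique n u)

subsets-unique : ∀ k → Unique (subsets k)
subsets-unique k = vectors-unique k (((λ ()) ∷ []) ∷ [] ∷ [])

∈-subsets : ∀ {k} (S : Subset k) → S L.∈ subsets k
∈-subsets = ∈-vectors λ { true → here refl ; false → there (here refl) }

∑-vectors : ∀ (xs : List A) n (f : Vec A (suc n) → ℤ) →
            ∑ (vectors xs (suc n)) f ≡ ∑[ a ∈ xs ] ∑[ v ∈ vectors xs n ] f (a ∷ v)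
∑-vectors xs n f = go xs
  where
  go : ∀ ys → ∑ (cartesianProductWith _∷_ ys (vectors xs n)) f ≡
              ∑[ a ∈ ys ] ∑[ v ∈ vectors xs n ] f (a ∷ v)
  go []       = refl
  go (y ∷ ys) = trans (∑-++ (map (y ∷_) (vectors xs n)) _ f)
                      (cong₂ _+_ (∑-map (y ∷_) (vectors xs n) f) (go ys))

∈-tabulate-does⁺ : {R : Fin n → Set} (R? : Decidable R) → ∀ {i} → R i → i ∈ Vec.tabulate (does ∘ R?)
∈-tabulate-does⁺ R? {i} r = Vec.lookup⇒[]= i _ (trans (Vec.lookup∘tabulate _ i) (does-true (R? i)))
  where
  does-true : (P? : Dec _) → does P? ≡ true
  does-true (yes _) = refl
  does-true (no ¬r) = contradiction r ¬r

∈-tabulate-does⁻ : {R : Fin n → Set} (R? : Decidable R) → ∀ {i} → i ∈ Vec.tabulate (does ∘ R?) → R i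
∈-tabulate-does⁻ R? {i} i∈
  with R? i | trans (sym (Vec.lookup∘tabulate (does ∘ R?) i)) (Vec.[]=⇒lookup i∈)
... | yes r | _ = r
... | no  _ | ()

-- Lists without repetition

unique-map-injective : ∀ (f : A → A′) {xs} → Unique (map f xs) → ∀ {x y} →
                       x L.∈ xs → y L.∈ xs → f x ≡ f y → x ≡ y
unique-map-injective f (_ ∷ _)  (here refl) (here refl) _  = refl
unique-map-injective f (x∉ ∷ _) (here refl) (there y∈)  eq =
  contradiction eq (All.lookup x∉ (∈-map⁺ f y∈))
unique-map-injective f (y∉ ∷ _) (there x∈)  (here refl) eq =
  contradiction (sym eq) (All.lookup y∉ (∈-map⁺ f x∈))
unique-map-injective f (_ ∷ u)  (there x∈)  (there y∈)  eq = unique-map-injective f u x∈ y∈ eq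

unique-rotate : ∀ (xs : List A) {y} → Unique (xs ++ [ y ]) → Unique (y ∷ xs)
unique-rotate []       u        = u
unique-rotate (x ∷ xs) (x∉ ∷ u) with unique-rotate xs u
... | y∉ ∷ u′ = ((All.lookup x∉ (∈-++⁺ʳ xs (here refl)) ∘ sym) ∷ y∉) ∷ All.++⁻ˡ xs x∉ ∷ u′

-- Two such lists are permutations of each other. This computes a degree by naming the darts that
-- are counted.
length-unique-≋ : ∀ {xs ys : List A} → Unique xs → Unique ys →
                  (∀ {x} → x L.∈ xs ⇔ x L.∈ ys) → length xs ≡ length ys
length-unique-≋ u u′ eq = ↭-length (∼bag⇒↭ (unique∧set⇒bag u u′ eq))

-- The Möbius function of the lattice

module _ (G : GainGraph n) where

  private
    -- Opaque because with-abstraction normalises the goal, and the normal form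
    -- of Latᵇ G is enormous.
    opaque
      Lat : List (EdgeSet G)
      Lat = Latᵇ G

      ∑-Lat : ∀ f → - ∑ (Latᵇ G) f ≡ - ∑ Lat f
      ∑-Lat f = refl

    -- The summand of the recursion is local to `μ-acc` and has no name outside it. It is handed
    -- over as an existential witness, which `summand≡` then evaluates.
    μ-acc-expansion : ∀ S T (rec : ∀ {R} → R ⊂ T → Acc _⊂_ R) → S ≢ T →
      ∃ λ (summand : EdgeSet G → ℤ) → μ-acc G S T (acc rec) ≡ - (∑[ R ∈ Lat ] summand R)
    μ-acc-expansion S T rec S≢T with S ≟ₛ T
    ... | yes S≡T = contradiction S≡T S≢T
    ... | no  _   = _ , ∑-Lat _

    -- The recursion reaches `R` with the proof `rec R⊂T`, while `μ G S R` uses `⊂-wellFounded R`.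
    -- Identifying the two values turns the recursion into one for `μ` itself.
    Irrelevant : EdgeSet G → EdgeSet G → Set
    Irrelevant S T = ∀ p q → μ-acc G S T p ≡ μ-acc G S T q

    summand≡ : ∀ S T (rec : ∀ {R} → R ⊂ T → Acc _⊂_ R) (S≢T : S ≢ T) →
      (∀ {R} → R ⊂ T → Irrelevant S R) → ∀ R →
      proj₁ (μ-acc-expansion S T rec S≢T) R ≡ μ G S R * 𝟙 (S ⊆? R ×-dec R ⊂? T)
    summand≡ S T rec S≢T irr R with S ≟ₛ T
    ... | yes S≡T = contradiction S≡T S≢T
    ... | no  _ with S ⊆? R | R ⊂? T
    ...   | yes _ | yes R⊂T =
      trans (irr R⊂T (rec R⊂T) (⊂-wellFounded R)) (sym (ℤ.*-identityʳ (μ G S R)))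
    ...   | yes _ | no  _   = sym (ℤ.*-zeroʳ (μ G S R))
    ...   | no  _ | yes _   = sym (ℤ.*-zeroʳ (μ G S R))
    ...   | no  _ | no  _   = sym (ℤ.*-zeroʳ (μ G S R))

    -- Irrelevance is assumed only strictly below `T`, so this formula is available inside the
    -- induction that establishes irrelevance. Its right-hand side does not mention `a`.
    μ-acc-≢ : ∀ S T a → S ≢ T → (∀ {R} → R ⊂ T → Irrelevant S R) →
      μ-acc G S T a ≡ - (∑[ R ∈ Latᵇ G ] μ G S R * 𝟙 (S ⊆? R ×-dec R ⊂? T))
    μ-acc-≢ S T (acc rec) S≢T irr = begin
      μ-acc G S T (acc rec)
        ≡⟨ proj₂ (μ-acc-expansion S T rec S≢T) ⟩
      - ∑ Lat (proj₁ (μ-acc-expansion S T rec S≢T))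
        ≡⟨ cong -_ (∑-cong Lat (λ R _ → summand≡ S T rec S≢T irr R)) ⟩
      - (∑[ R ∈ Lat ] μ G S R * 𝟙 (S ⊆? R ×-dec R ⊂? T))
        ≡⟨ ∑-Lat (λ R → μ G S R * 𝟙 (S ⊆? R ×-dec R ⊂? T)) ⟨
      - (∑[ R ∈ Latᵇ G ] μ G S R * 𝟙 (S ⊆? R ×-dec R ⊂? T)) ∎
      where open ≡-Reasoning

    μ-acc-≡ : ∀ S a → μ-acc G S S a ≡ 1ℤ
    μ-acc-≡ S (acc rec) with S ≟ₛ S
    ... | yes _   = refl
    ... | no  S≢S = contradiction refl S≢S

    μ-acc-irrelevant : ∀ S T → Acc _⊂_ T → Irrelevant S T
    μ-acc-irrelevant S T (acc rs) p q = go (S ≟ₛ T) p q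
      where
      irr : ∀ {R} → R ⊂ T → Irrelevant S R
      irr {R} R⊂T = μ-acc-irrelevant S R (rs R⊂T)

      go : Dec (S ≡ T) → Irrelevant S T
      go (yes refl) p q = trans (μ-acc-≡ S p) (sym (μ-acc-≡ S q))
      go (no  S≢T)  p q = trans (μ-acc-≢ S T p S≢T irr) (sym (μ-acc-≢ S T q S≢T irr))

  μ-refl : ∀ S → μ G S S ≡ 1ℤ
  μ-refl S = μ-acc-≡ S (⊂-wellFounded S)

  μ-≢ : ∀ {S T} → S ≢ T → μ G S T ≡ - (∑[ R ∈ Latᵇ G ] μ G S R * 𝟙 (S ⊆? R ×-dec R ⊂? T))
  μ-≢ {S} {T} S≢T = μ-acc-≢ S T (⊂-wellFounded T) S≢T
    (λ {R} _ → μ-acc-irrelevant S R (⊂-wellFounded R))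

  Latᵇ-unique : Unique (Latᵇ G)
  Latᵇ-unique = Unique.filter⁺ _ (subsets-unique _)

  ∈-Latᵇ : ∀ {B} → Balanced G B → Closed G B → B L.∈ Latᵇ G
  ∈-Latᵇ bal closed = ∈-filter⁺ _ (∈-subsets _) (bal , closed)

  Latᵇ-balanced : ∀ {B} → B L.∈ Latᵇ G → Balanced G B
  Latᵇ-balanced B∈ =
    proj₁ (proj₂ (∈-filter⁻ (λ B → balanced? G B ×-dec closed? G B) {xs = subsets _} B∈))

  ⊆⇒⊂⊎≡ : ∀ {S T : EdgeSet G} → S ⊆ T → S ⊂ T ⊎ S ≡ T
  ⊆⇒⊂⊎≡ {S} {T} S⊆T with S ⊂? T
  ... | yes S⊂T = inj₁ S⊂T
  ... | no  S⊄T = inj₂ (Sub.⊆-antisym S⊆T T⊆S)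
    where
    T⊆S : T ⊆ S
    T⊆S {e} e∈T with e ∈? S
    ... | yes e∈S = e∈S
    ... | no  e∉S = contradiction ((λ {x} → S⊆T {x}) , e , e∈T , e∉S) S⊄T

  -- The condition `B ⊆ C` splits into `B ⊂ C` and `B ≡ C`. The second part contributes `μ G ⊥ C`,
  -- which for `C` other than `⊥` is by recursion the negative of the first; for `C ≡ ⊥` the first
  -- part is empty and `μ-refl` remains.
  ∑-μ⊥ : ∀ {C} → C L.∈ Latᵇ G →
         ∑[ B ∈ Latᵇ G ] (μ G ⊥ B * 𝟙 (B ⊆? C)) ≡ 𝟙 (⊥ ≟ₛ C)
  ∑-μ⊥ {C} C∈ = begin
    ∑[ B ∈ Latᵇ G ] (μ G ⊥ B * 𝟙 (B ⊆? C))
      ≡⟨ ∑-cong (Latᵇ G) (λ B _ → trans (cong (μ G ⊥ B *_) (split B))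
           (ℤ.*-distribˡ-+ (μ G ⊥ B) _ _)) ⟩
    ∑[ B ∈ Latᵇ G ] (μ G ⊥ B * 𝟙 (⊥ ⊆? B ×-dec B ⊂? C) + μ G ⊥ B * 𝟙 (B ≟ₛ C))
      ≡⟨ ∑-+ (Latᵇ G) _ _ ⟩
    (∑[ B ∈ Latᵇ G ] μ G ⊥ B * 𝟙 (⊥ ⊆? B ×-dec B ⊂? C)) + (∑[ B ∈ Latᵇ G ] μ G ⊥ B * 𝟙 (B ≟ₛ C))
      ≡⟨ cong (λ s → (∑[ B ∈ Latᵇ G ] μ G ⊥ B * 𝟙 (⊥ ⊆? B ×-dec B ⊂? C)) + s)
           (∑-𝟙≡ _≟ₛ_ (Latᵇ G) Latᵇ-unique C C∈ (μ G ⊥)) ⟩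
    (∑[ B ∈ Latᵇ G ] μ G ⊥ B * 𝟙 (⊥ ⊆? B ×-dec B ⊂? C)) + μ G ⊥ C
      ≡⟨ collect (⊥ ≟ₛ C) ⟩
    𝟙 (⊥ ≟ₛ C) ∎
    where
    open ≡-Reasoning

    split : ∀ B → 𝟙 (B ⊆? C) ≡ 𝟙 (⊥ ⊆? B ×-dec B ⊂? C) + 𝟙 (B ≟ₛ C)
    split B with B ≟ₛ C
    ... | yes refl = trans (𝟙-yes (B ⊆? B) id) (cong (_+ 1ℤ)
      (sym (𝟙-no (⊥ ⊆? B ×-dec B ⊂? B) λ { (_ , _ , _ , x∈ , x∉) → x∉ x∈ })))
    ... | no  B≢C  = trans (𝟙-cong (B ⊆? C) (⊥ ⊆? B ×-dec B ⊂? C)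
      (λ B⊆C → Sub.⊥⊆ , [ id , (λ B≡C → contradiction B≡C B≢C) ]′ (⊆⇒⊂⊎≡ B⊆C))
      (proj₁ ∘ proj₂)) (sym (ℤ.+-identityʳ _))

    collect : ∀ {C} (d : Dec (⊥ ≡ C)) →
      (∑[ B ∈ Latᵇ G ] μ G ⊥ B * 𝟙 (⊥ ⊆? B ×-dec B ⊂? C)) + μ G ⊥ C ≡ 𝟙 d
    collect (yes refl) = cong₂ _+_
      (trans (∑-cong (Latᵇ G) λ B _ → trans
        (cong (μ G ⊥ B *_) (𝟙-no (⊥ ⊆? B ×-dec B ⊂? ⊥)
          λ { (_ , _ , _ , x∈ , _) → Sub.∉⊥ x∈ }))
        (ℤ.*-zeroʳ (μ G ⊥ B))) (∑-zero (Latᵇ G)))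
      (μ-refl ⊥)
    collect {C} (no ⊥≢C) = trans (cong (ℤ._+_ s) (μ-≢ ⊥≢C)) (ℤ.+-inverseʳ s)
      where
      s : ℤ
      s = ∑[ B ∈ Latᵇ G ] μ G ⊥ B * 𝟙 (⊥ ⊆? B ×-dec B ⊂? C)

-- Walks

module _ (G : GainGraph n) where
  open GainGraph G using (size)

  open DecMembership (Fin._≟_ {n}) using () renaming (_∈?_ to _∈ᵥ?_)
  open DecMembership (Fin._≟_ {size}) using () renaming (_∈?_ to _∈ₑ?_)

  reverseDart : Dart G → Dart G
  reverseDart (e , s) = e , opposite s

  tail-reverse : ∀ d → tail G (reverseDart d) ≡ head G d
  tail-reverse (e , Sign.+) = refl
  tail-reverse (e , Sign.-) = refl

  head-reverse : ∀ d → head G (reverseDart d) ≡ tail G d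
  head-reverse (e , Sign.+) = refl
  head-reverse (e , Sign.-) = refl

  φ-reverse : ∀ d → φ G (reverseDart d) ≡ - φ G d
  φ-reverse (e , Sign.+) = refl
  φ-reverse (e , Sign.-) = sym (ℤ.neg-involutive _)

  reverse≢ : ∀ d → d ≢ reverseDart d
  reverse≢ (e , Sign.+) ()
  reverse≢ (e , Sign.-) ()

  sameEdge : ∀ c d → edge G c ≡ edge G d → c ≡ d ⊎ c ≡ reverseDart d
  sameEdge (e , Sign.+) (.e , Sign.+) refl = inj₁ refl
  sameEdge (e , Sign.+) (.e , Sign.-) refl = inj₂ refl
  sameEdge (e , Sign.-) (.e , Sign.+) refl = inj₂ refl
  sameEdge (e , Sign.-) (.e , Sign.-) refl = inj₁ refl

  Walk : EdgeSet G → Fin n → List (Dart G) → Fin n → Set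
  Walk B u ds v = IsWalk G u ds v × All (λ d → edge G d ∈ B) ds

  path⇒walk : ∀ {B u ds v} → IsPath G B u ds v → Walk B u ds v
  path⇒walk (wk , in-B , _) = wk , in-B

  isWalk-++ : ∀ {u v w} ds {es} → IsWalk G u ds v → IsWalk G v es w → IsWalk G u (ds ++ es) w
  isWalk-++ []       refl        wk′ = wk′
  isWalk-++ (d ∷ ds) (u≡ , wk) wk′ = u≡ , isWalk-++ ds wk wk′

  walk-++ : ∀ {B u v w ds es} → Walk B u ds v → Walk B v es w → Walk B u (ds ++ es) w
  walk-++ {ds = ds} (wk , in-B) (wk′ , in-B′) = isWalk-++ ds wk wk′ , All.++⁺ in-B in-B′

  totalGain-++ : ∀ ds es → totalGain G (ds ++ es) ≡ totalGain G ds + totalGain G es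
  totalGain-++ ds es = ∑-++ ds es (φ G)

  reverseWalk : List (Dart G) → List (Dart G)
  reverseWalk []       = []
  reverseWalk (d ∷ ds) = reverseWalk ds ++ [ reverseDart d ]

  walk-reverse : ∀ {B u v} ds → Walk B u ds v → Walk B v (reverseWalk ds) u
  walk-reverse []       (refl , [])            = refl , []
  walk-reverse (d ∷ ds) ((refl , wk) , e∈ ∷ in-B) =
    walk-++ (walk-reverse ds (wk , in-B)) ((sym (tail-reverse d) , head-reverse d) , e∈ ∷ [])

  totalGain-reverse : ∀ ds → totalGain G (reverseWalk ds) ≡ - totalGain G ds
  totalGain-reverse []       = refl
  totalGain-reverse (d ∷ ds) = begin
    totalGain G (reverseWalk ds ++ [ reverseDart d ])
      ≡⟨ totalGain-++ (reverseWalk ds) [ reverseDart d ] ⟩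
    totalGain G (reverseWalk ds) + (φ G (reverseDart d) + 0ℤ)
      ≡⟨ cong₂ (λ a b → a + (b + 0ℤ)) (totalGain-reverse ds) (φ-reverse d) ⟩
    - totalGain G ds + (- φ G d + 0ℤ)
      ≡⟨ lemma (totalGain G ds) (φ G d) ⟩
    - (φ G d + totalGain G ds) ∎
    where
    open ≡-Reasoning
    lemma : ∀ a b → - a + (- b + 0ℤ) ≡ - (b + a)
    lemma = ℤ-Solver.solve-∀

  end∈vertices : ∀ {u v} ds → IsWalk G u ds v → v L.∈ vertices G u ds
  end∈vertices []       refl     = here refl
  end∈vertices (d ∷ ds) (_ , wk) = there (end∈vertices ds wk)

  tail∈vertices : ∀ {u v} d ds → IsWalk G u ds v → edge G d L.∈ map (edge G) ds →
                  tail G d L.∈ vertices G u ds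
  tail∈vertices d (c ∷ ds) (refl , wk) (there e∈) = there (tail∈vertices d ds wk e∈)
  tail∈vertices d (c ∷ ds) (refl , wk) (here e≡) with sameEdge d c e≡
  ... | inj₁ refl = here refl
  ... | inj₂ refl = there (here (tail-reverse c))

  head∈vertices : ∀ {u v} d ds → IsWalk G u ds v → edge G d L.∈ map (edge G) ds →
                  head G d L.∈ vertices G u ds
  head∈vertices d ds wk e∈ =
    subst (L._∈ _) (tail-reverse d) (tail∈vertices (reverseDart d) ds wk e∈)

  closedPath-empty : ∀ {u} ds → IsWalk G u ds u → Unique (vertices G u ds) → ds ≡ []
  closedPath-empty []       _        _        = refl
  closedPath-empty (d ∷ ds) (_ , wk) (u∉ ∷ _) =
    contradiction refl (All.lookup u∉ (end∈vertices ds wk))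

  path-split : ∀ {B u v w} ds → IsPath G B u ds v → w L.∈ vertices G u ds →
               ∃₂ λ as bs → ds ≡ as ++ bs × IsPath G B u as w × IsPath G B w bs v
  path-split ds p (here refl) = [] , ds , refl , (refl , [] , [] ∷ []) , p
  path-split (d ∷ ds) ((refl , wk) , e∈ ∷ in-B , u∉ ∷ uniq) (there w∈)
    with as , bs , refl , (wk₁ , in-B₁ , uniq₁) , q ← path-split ds (wk , in-B , uniq) w∈ =
      d ∷ as , bs , refl , ((refl , wk₁) , e∈ ∷ in-B₁ , u∉₁ ∷ uniq₁) , q
    where
    u∉₁ : All (tail G d ≢_) (map (head G) (d ∷ as))
    u∉₁ = All.++⁻ˡ (map (head G) (d ∷ as))
                   (subst (All (tail G d ≢_)) (List.map-++ (head G) (d ∷ as) bs) u∉)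

  -- Using an edge again, in either direction, would bring the walk back to the tail of its first
  -- use.
  path-edges-unique : ∀ {u v} ds → IsWalk G u ds v → Unique (vertices G u ds) →
                      Unique (map (edge G) ds)
  path-edges-unique []       _           _           = []
  path-edges-unique (d ∷ ds) (refl , wk) (u∉ ∷ uniq) =
    All.¬Any⇒All¬ _ (λ e∈ → All.lookup u∉ (tail∈vertices d ds wk e∈) refl)
    ∷ path-edges-unique ds wk uniq

  -- Balance in the form that loop erasure consumes. The path may contain the edge of `d` itself, so
  -- the case of an edge run forth and back, which is no circle, is included.
  CyclesNeutral : EdgeSet G → Set
  CyclesNeutral B = ∀ d ds → edge G d ∈ B → IsPath G B (head G d) ds (tail G d) →
                    totalGain G (d ∷ ds) ≡ 0ℤ

  -- Loop erasure from the right: if the tail of the new dart already lies on the shortened path,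
  -- the dart and the initial segment up to that vertex form a cycle and are cut off. Neutrality is
  -- needed only for the gain, so it stands inside the conclusion and the same construction gives
  -- joinedness for arbitrary `B`.
  shorten : ∀ {B u v} ds → Walk B u ds v →
            ∃ λ ps → IsPath G B u ps v × (CyclesNeutral B → totalGain G ps ≡ totalGain G ds)
  shorten []       (refl , [])               = [] , (refl , [] , [] ∷ []) , λ _ → refl
  shorten (d ∷ ds) ((refl , wk) , e∈ ∷ in-B)
    with ps , p@(pwk , pin-B , uniq) , same ← shorten ds (wk , in-B)
    with tail G d ∈ᵥ? vertices G (head G d) ps
  ... | no  t∉ = d ∷ ps , ((refl , pwk) , e∈ ∷ pin-B , All.¬Any⇒All¬ _ t∉ ∷ uniq) ,
                 λ neutral → cong (ℤ._+_ (φ G d)) (same neutral)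
  ... | yes t∈ with as , bs , refl , p₁ , p₂ ← path-split ps p t∈ =
    bs , p₂ , λ neutral → begin
      totalGain G bs
        ≡⟨ ℤ.+-identityˡ _ ⟨
      0ℤ + totalGain G bs
        ≡⟨ cong (_+ totalGain G bs) (neutral d as e∈ p₁) ⟨
      totalGain G (d ∷ as) + totalGain G bs
        ≡⟨ totalGain-++ (d ∷ as) bs ⟨
      φ G d + totalGain G (as ++ bs)
        ≡⟨ cong (ℤ._+_ (φ G d)) (same neutral) ⟩
      φ G d + totalGain G ds ∎
    where open ≡-Reasoning

  walk⇒joined : ∀ {B u v} ds → Walk B u ds v → Joined G B u v
  walk⇒joined ds w with ps , p , _ ← shorten ds w = ps , p

  joined-refl : ∀ {B u} → Joined G B u u
  joined-refl = [] , refl , [] , [] ∷ []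

  joined-sym : ∀ {B u v} → Joined G B u v → Joined G B v u
  joined-sym (ds , p) = walk⇒joined (reverseWalk ds) (walk-reverse ds (path⇒walk p))

  joined-trans : ∀ {B u v w} → Joined G B u v → Joined G B v w → Joined G B u w
  joined-trans (ds , p) (es , q) = walk⇒joined (ds ++ es) (walk-++ (path⇒walk p) (path⇒walk q))

  vertices-joined : ∀ {B u v w} ds → IsPath G B u ds v → w L.∈ vertices G u ds → Joined G B u w
  vertices-joined ds p w∈ with as , _ , _ , q , _ ← path-split ds p w∈ = as , q

  vertices≡tails : ∀ {u v} ds → IsWalk G u ds v → vertices G u ds ≡ map (tail G) ds ++ [ v ]
  vertices≡tails []       refl        = refl
  vertices≡tails (d ∷ ds) (refl , wk) = cong (tail G d ∷_) (vertices≡tails ds wk)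

  darts-unique : Unique (darts G)
  darts-unique = Unique.cartesianProduct⁺ (Unique.allFin⁺ size) (((λ ()) ∷ []) ∷ [] ∷ [])

  -- The circle formed by a path and a closing edge

  module Cycle {B} (d : Dart G) (ds : List (Dart G)) (p : IsPath G B (head G d) ds (tail G d))
               (d∉ : ¬ edge G d L.∈ map (edge G) ds) where

    cycle : List (Dart G)
    cycle = d ∷ ds

    edges : EdgeSet G
    edges = Vec.tabulate (does ∘ (_∈ₑ? map (edge G) cycle))

    vertexSet : Subset n
    vertexSet = Vec.tabulate (does ∘ (_∈ᵥ? map (head G) cycle))

    ∈-edges : ∀ {e} → e ∈ edges ⇔ e L.∈ map (edge G) cycle
    ∈-edges = mk⇔ (∈-tabulate-does⁻ (_∈ₑ? map (edge G) cycle))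
                  (∈-tabulate-does⁺ (_∈ₑ? map (edge G) cycle))

    ∈-vertexSet : ∀ {v} → v ∈ vertexSet ⇔ v L.∈ map (head G) cycle
    ∈-vertexSet = mk⇔ (∈-tabulate-does⁻ (_∈ᵥ? map (head G) cycle))
                      (∈-tabulate-does⁺ (_∈ᵥ? map (head G) cycle))

    isWalk : IsWalk G (tail G d) cycle (tail G d)
    isWalk = refl , proj₁ p

    path-in-edges : IsPath G edges (head G d) ds (tail G d)
    path-in-edges = proj₁ p , All.tabulate (λ c∈ → from ∈-edges (there (∈-map⁺ _ c∈))) ,
                    proj₂ (proj₂ p)

    heads-unique : Unique (map (head G) cycle)
    heads-unique = proj₂ (proj₂ p)

    -- Around a closed walk the tails are the heads moved by one place.
    tails-unique : Unique (map (tail G) cycle)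
    tails-unique = unique-rotate _ (subst Unique (vertices≡tails ds (proj₁ p)) heads-unique)

    edges-unique : Unique (map (edge G) cycle)
    edges-unique = All.¬Any⇒All¬ _ d∉ ∷ path-edges-unique ds (proj₁ p) heads-unique

    head∈tails : ∀ {v} → v L.∈ map (head G) cycle → v L.∈ map (tail G) cycle
    head∈tails v∈
      with ∈-++⁻ (map (tail G) ds) (subst (_ L.∈_) (vertices≡tails ds (proj₁ p)) v∈)
    ... | inj₁ v∈tails     = there v∈tails
    ... | inj₂ (here refl) = here refl

    tail∈heads : ∀ c → edge G c L.∈ map (edge G) cycle → tail G c L.∈ map (head G) cycle
    tail∈heads c e∈ with tail∈vertices c cycle isWalk e∈
    ... | here eq  = subst (L._∈ _) (sym eq) (end∈vertices ds (proj₁ p))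
    ... | there t∈ = t∈

    -- The darts of the circle with tail `v` are `out`, by which the traversal leaves `v`, and the
    -- reverse of `inn`, by which it arrives. They differ even for a loop, where `out` and `inn`
    -- coincide, since no dart is its own reverse.
    degree≡2 : ∀ v → v ∈ vertexSet → degree G edges v ≡ 2
    degree≡2 v v∈
      with out , out∈ , refl ← ∈-map⁻ (tail G) {xs = cycle} (head∈tails (to ∈-vertexSet v∈))
         | inn , inn∈ , v≡ ← ∈-map⁻ (head G) {xs = cycle} (to ∈-vertexSet v∈) =
      length-unique-≋ (Unique.filter⁺ at-v? darts-unique) ((out≢ ∷ []) ∷ [] ∷ [])
                      (mk⇔ (leaving ∘ ∈-filter⁻ at-v? {xs = darts G}) arriving)
      where
      at-v? = λ c → (edge G c ∈? edges) ×-dec (tail G c Fin.≟ tail G out)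

      out≢ : out ≢ reverseDart inn
      out≢ eq = reverse≢ out (trans eq (cong reverseDart
        (sym (unique-map-injective (edge G) edges-unique out∈ inn∈ (cong (edge G) eq)))))

      leaving : ∀ {c} → c L.∈ darts G × edge G c ∈ edges × tail G c ≡ tail G out →
                c L.∈ out ∷ reverseDart inn ∷ []
      leaving {c} (_ , e∈ , t≡)
        with b , b∈ , e≡ ← ∈-map⁻ (edge G) {xs = cycle} (to ∈-edges e∈)
        with sameEdge c b e≡
      ... | inj₁ refl = here (unique-map-injective (tail G) tails-unique b∈ out∈ t≡)
      ... | inj₂ refl = there (here (cong reverseDart (unique-map-injective (head G) heads-unique
                          b∈ inn∈ (trans (sym (tail-reverse b)) (trans t≡ v≡)))))

      arriving : ∀ {c} → c L.∈ out ∷ reverseDart inn ∷ [] → c L.∈ filter at-v? (darts G)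
      arriving (here refl)         =
        ∈-filter⁺ at-v? (∈-darts G out) (from ∈-edges (∈-map⁺ _ out∈) , refl)
      arriving (there (here refl)) =
        ∈-filter⁺ at-v? (∈-darts G (reverseDart inn))
          (from ∈-edges (∈-map⁺ _ inn∈) , trans (tail-reverse inn) (sym v≡))

    isCircle : IsCircle G vertexSet edges
    isCircle = record
      { nonempty  = head G d , from ∈-vertexSet (here refl)
      ; subgraph  = λ c e∈ → from ∈-vertexSet (tail∈heads c (to ∈-edges e∈))
      ; regular   = degree≡2
      ; connected = λ u v u∈ v∈ → joined-trans
          (joined-sym (vertices-joined ds path-in-edges (to ∈-vertexSet u∈)))
          (vertices-joined ds path-in-edges (to ∈-vertexSet v∈))
      }

    traverses : Traverses G edges (tail G d) cycle
    traverses = isWalk , edges-unique , λ _ → ∈-edges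

  -- Balance in terms of walks

  -- If the closing edge is not on the path, the two form a circle. If it is, the path can only be
  -- the reverse of `d`, and the gains cancel.
  balanced⇒cyclesNeutral : ∀ {B} → Balanced G B → CyclesNeutral B
  balanced⇒cyclesNeutral {B} bal d ds e∈ p@(wk , in-B , uniq)
    with edge G d ∈ₑ? map (edge G) ds
  ... | no d∉ = bal vertexSet edges isCircle edges⊆B (tail G d) cycle traverses
    where
    open Cycle d ds p d∉
    edges⊆B : edges ⊆ B
    edges⊆B e∈C with ∈-map⁻ (edge G) {xs = cycle} (to ∈-edges e∈C)
    ... | c , here refl , refl = e∈
    ... | c , there c∈  , refl = All.lookup in-B c∈
  ... | yes d∈ = retraced ds wk uniq d∈
    where
    retraced : ∀ ds → IsWalk G (head G d) ds (tail G d) → Unique (vertices G (head G d) ds) →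
               edge G d L.∈ map (edge G) ds → totalGain G (d ∷ ds) ≡ 0ℤ
    -- Meeting the edge after the first dart would mean visiting its head, the start of the path, a
    -- second time.
    retraced (a ∷ as) (h≡ , wk) (h∉ ∷ uniq) (there d∈) =
      contradiction refl (All.lookup h∉ (head∈vertices d as wk d∈))
    retraced (a ∷ as) (h≡ , wk) (h∉ ∷ uniq) (here e≡) with sameEdge d a e≡
    -- Here `d` would be a loop, and a path with at least one dart cannot end where it starts.
    ... | inj₁ refl = contradiction h≡ (All.lookup h∉ (end∈vertices as wk))
    -- After the reverse of `d` the path is already at its endpoint, so nothing follows.
    ... | inj₂ refl with refl ← closedPath-empty as
                          (subst (IsWalk G (head G a) as) (tail-reverse a) wk) uniq =
      trans (cong (_+ (φ G a + 0ℤ)) (φ-reverse a)) (lemma (φ G a))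
      where
      lemma : ∀ a → - a + (a + 0ℤ) ≡ 0ℤ
      lemma = ℤ-Solver.solve-∀

  -- Shortening keeps the gain and leaves a path from `u` to `u`, which has no edges.
  balanced⇒closedWalk-neutral : ∀ {B} → Balanced G B → ∀ {u} ds → Walk B u ds u →
                                totalGain G ds ≡ 0ℤ
  balanced⇒closedWalk-neutral bal ds w
    with ps , (wk , _ , uniq) , same ← shorten ds w
    with refl ← closedPath-empty ps wk uniq = sym (same (balanced⇒cyclesNeutral bal))

  module _ {B} (bal : Balanced G B) where

    walk-gain-unique : ∀ {u v} ds es → Walk B u ds v → Walk B u es v →
                       totalGain G ds ≡ totalGain G es
    walk-gain-unique ds es w w′ = begin
      totalGain G ds
        ≡⟨ lemma (totalGain G ds) (totalGain G es) ⟩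
      (totalGain G ds + - totalGain G es) + totalGain G es
        ≡⟨ cong (λ g → (totalGain G ds + g) + totalGain G es) (totalGain-reverse es) ⟨
      (totalGain G ds + totalGain G (reverseWalk es)) + totalGain G es
        ≡⟨ cong (_+ totalGain G es) (totalGain-++ ds (reverseWalk es)) ⟨
      totalGain G (ds ++ reverseWalk es) + totalGain G es
        ≡⟨ cong (_+ totalGain G es) (balanced⇒closedWalk-neutral bal (ds ++ reverseWalk es)
             (walk-++ w (walk-reverse es w′))) ⟩
      0ℤ + totalGain G es
        ≡⟨ ℤ.+-identityˡ _ ⟩
      totalGain G es ∎
      where
      open ≡-Reasoning
      lemma : ∀ a b → a ≡ (a + - b) + b
      lemma = ℤ-Solver.solve-∀

  gainOf : ∀ {B u v} → Dec (Joined G B u v) → ℤ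
  gainOf (yes (ds , _)) = totalGain G ds
  gainOf (no _)         = 0ℤ

  -- Junk value 0 if u and v lie in different components.
  gainBetween : EdgeSet G → Fin n → Fin n → ℤ
  gainBetween B u v = gainOf (joined? G B u v)

  module _ {B} (bal : Balanced G B) where

    gainBetween-walk : ∀ {u v} ds → Walk B u ds v → gainBetween B u v ≡ totalGain G ds
    gainBetween-walk {u} {v} ds w = go (joined? G B u v)
      where
      go : (j? : Dec (Joined G B u v)) → gainOf j? ≡ totalGain G ds
      go (yes (ps , p)) = walk-gain-unique bal ps ds (path⇒walk p) w
      go (no ¬j)        = contradiction (walk⇒joined ds w) ¬j

    gainBetween-refl : ∀ u → gainBetween B u u ≡ 0ℤ
    gainBetween-refl u = gainBetween-walk {u} [] (refl , [])

    gainBetween-trans : ∀ {u v w} → Joined G B u v → Joined G B v w →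
                        gainBetween B u v + gainBetween B v w ≡ gainBetween B u w
    gainBetween-trans {u} {v} {w} (ds , p) (es , q) = begin
      gainBetween B u v + gainBetween B v w
        ≡⟨ cong₂ _+_ (gainBetween-walk ds (path⇒walk p)) (gainBetween-walk es (path⇒walk q)) ⟩
      totalGain G ds + totalGain G es
        ≡⟨ totalGain-++ ds es ⟨
      totalGain G (ds ++ es)
        ≡⟨ gainBetween-walk (ds ++ es) (walk-++ (path⇒walk p) (path⇒walk q)) ⟨
      gainBetween B u w ∎
      where open ≡-Reasoning

-- Counting

-- Counting by successive choices: by `local` the constraint at `i` sees only earlier coordinates,
-- and by `count` each admissible choice of these leaves `k i` values. The induction fixes the first
-- coordinate and moves it into the constraints on the others.
∑-triangular :
  A → ∀ (xs : List A) n (C : Fin n → Vec A n → A → Set) (C? : ∀ i x a → Dec (C i x a))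
  (k : Fin n → ℤ) →
  (∀ i {x y a} → (∀ j → j Fin.< i → lookup x j ≡ lookup y j) → C i x a → C i y a) →
  (∀ i x → (∀ j → j Fin.< i → C j x (lookup x j)) → ∑[ a ∈ xs ] 𝟙 (C? i x a) ≡ k i) →
  ∑[ x ∈ vectors xs n ] 𝟙 (Fin.all? (λ i → C? i x (lookup x i))) ≡ ∏ (allFin n) k
∑-triangular a₀ xs zero    C C? k local count =
  cong (_+ 0ℤ) (𝟙-yes (Fin.all? (λ i → C? i [] (lookup [] i))) (λ ()))
∑-triangular {A = A} a₀ xs (suc n) C C? k local count = begin
  ∑[ x ∈ vectors xs (suc n) ] 𝟙 (all? x)
    ≡⟨ ∑-vectors xs n (𝟙 ∘ all?) ⟩
  ∑[ a ∈ xs ] ∑[ v ∈ vectors xs n ] 𝟙 (all? (a ∷ v))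
    ≡⟨ ∑-cong xs (λ a _ → fibre a (C? Fin.zero x₀ a)) ⟩
  ∑[ a ∈ xs ] K * 𝟙 (C? Fin.zero x₀ a)
    ≡⟨ ∑-*ˡ xs K _ ⟩
  K * (∑[ a ∈ xs ] 𝟙 (C? Fin.zero x₀ a))
    ≡⟨ cong (K *_) (count Fin.zero x₀ (λ _ ())) ⟩
  K * k Fin.zero
    ≡⟨ ℤ.*-comm K (k Fin.zero) ⟩
  k Fin.zero * K
    ≡⟨ ∏-allFin-suc n k ⟨
  ∏ (allFin (suc n)) k ∎
  where
  open ≡-Reasoning

  -- The constraint at index zero ignores its vector, so any vector may stand in; `a₀` supplies one
  -- even when `xs` is empty.
  x₀ : Vec A (suc n)
  x₀ = Vec.replicate (suc n) a₀

  K : ℤ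
  K = ∏ (allFin n) (k ∘ Fin.suc)

  all? : ∀ x → Dec (∀ i → C i x (lookup x i))
  all? x = Fin.all? (λ i → C? i x (lookup x i))

  at-zero : ∀ {x y a} → C Fin.zero x a → C Fin.zero y a
  at-zero = local Fin.zero (λ _ ())

  fibre : ∀ a (c? : Dec (C Fin.zero x₀ a)) →
          ∑[ v ∈ vectors xs n ] 𝟙 (all? (a ∷ v)) ≡ K * 𝟙 c?
  fibre a (no ¬c) = begin
    ∑[ v ∈ vectors xs n ] 𝟙 (all? (a ∷ v))
      ≡⟨ ∑-cong (vectors xs n) (λ v _ → 𝟙-no (all? (a ∷ v)) (λ c → ¬c (at-zero (c Fin.zero)))) ⟩
    ∑[ v ∈ vectors xs n ] 0ℤ
      ≡⟨ ∑-zero (vectors xs n) ⟩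
    0ℤ
      ≡⟨ ℤ.*-zeroʳ K ⟨
    K * 0ℤ ∎
  fibre a (yes c₀) = begin
    ∑[ v ∈ vectors xs n ] 𝟙 (all? (a ∷ v))
      ≡⟨ ∑-cong (vectors xs n) (λ v _ → 𝟙-cong (all? (a ∷ v))
           (Fin.all? (λ i → C? (Fin.suc i) (a ∷ v) (lookup v i)))
           (λ c i → c (Fin.suc i))
           (λ { c Fin.zero → at-zero c₀ ; c (Fin.suc i) → c i })) ⟩
    ∑[ v ∈ vectors xs n ] 𝟙 (Fin.all? (λ i → C? (Fin.suc i) (a ∷ v) (lookup v i)))
      ≡⟨ ∑-triangular a₀ xs n
           (λ i v → C (Fin.suc i) (a ∷ v)) (λ i v → C? (Fin.suc i) (a ∷ v)) (k ∘ Fin.suc)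
           (λ i agree → local (Fin.suc i)
             (λ { Fin.zero _ → refl ; (Fin.suc j) (s≤s j<i) → agree j j<i }))
           (λ i v c → count (Fin.suc i) (a ∷ v)
             (λ { Fin.zero _ → at-zero c₀ ; (Fin.suc j) (s≤s j<i) → c j j<i })) ⟩
    K
      ≡⟨ ℤ.*-identityʳ K ⟨
    K * 1ℤ ∎

unless : Dec P → ℤ → ℤ
unless (yes _) z = 1ℤ
unless (no _)  z = z

unless-⊎ : ∀ {R : Set} (P? : Dec P) (Q? : Dec Q) (R? : Dec R) z → (P ⊎ Q → R) → (R → P ⊎ Q) →
           unless P? (unless Q? z) ≡ unless R? z
unless-⊎ (yes p) _       (yes _) z f g = refl
unless-⊎ (yes p) _       (no ¬r) z f g = contradiction (f (inj₁ p)) ¬r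
unless-⊎ (no _)  (yes _) (yes _) z f g = refl
unless-⊎ (no _)  (yes q) (no ¬r) z f g = contradiction (f (inj₂ q)) ¬r
unless-⊎ (no ¬p) (no ¬q) (yes r) z f g = contradiction (g r) [ ¬p , ¬q ]′
unless-⊎ (no _)  (no _)  (no _)  z f g = refl

∏-filter-¬ : {R : A → Set} (R? : Decidable R) (xs : List A) (F : A → ℤ) →
             ∏ (filter (¬? ∘ R?) xs) F ≡ ∏[ x ∈ xs ] unless (R? x) (F x)
∏-filter-¬ R? []       F = refl
∏-filter-¬ R? (x ∷ xs) F with R? x
... | yes _ = trans (∏-filter-¬ R? xs F) (sym (ℤ.*-identityˡ _))
... | no  _ = cong (F x *_) (∏-filter-¬ R? xs F)

module _ (_≟_ : DecidableEquality A) where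

  earlier? : (f : Fin n → A) (i : Fin n) → Dec (∃ λ j → j Fin.< i × f j ≡ f i)
  earlier? f i = Fin.any? (λ j → (j Fin.<? i) ×-dec (f j ≟ f i))

  -- Deduplication keeps first occurrences, so an index carries a factor exactly when its value is
  -- new. Applied to `component`, this turns the product over `π` into the product over vertices
  -- that `∑-triangular` yields.
  ∏-deduplicate : ∀ n (f : Fin n → A) (F : A → ℤ) →
    ∏ (deduplicate _≟_ (map f (allFin n))) F ≡ ∏[ i ∈ allFin n ] unless (earlier? f i) (F (f i))
  ∏-deduplicate zero    f F = refl
  ∏-deduplicate (suc n) f F = begin
    F f₀ * ∏ (filter (¬? ∘ (f₀ ≟_)) (deduplicate _≟_ (map f (List.tabulate Fin.suc)))) F
      ≡⟨ cong (λ ys → F f₀ * ∏ (filter (¬? ∘ (f₀ ≟_)) (deduplicate _≟_ ys)) F)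
           (trans (cong (map f) (sym (List.map-tabulate id Fin.suc)))
                  (sym (List.map-∘ (allFin n)))) ⟩
    F f₀ * ∏ (filter (¬? ∘ (f₀ ≟_)) (deduplicate _≟_ (map f′ (allFin n)))) F
      ≡⟨ cong (F f₀ *_) (∏-filter-¬ (f₀ ≟_) (deduplicate _≟_ (map f′ (allFin n))) F) ⟩
    -- The filter is absorbed into the weight, which is why the induction runs over all `F`.
    F f₀ * ∏ (deduplicate _≟_ (map f′ (allFin n))) (λ y → unless (f₀ ≟ y) (F y))
      ≡⟨ cong (F f₀ *_) (∏-deduplicate n f′ (λ y → unless (f₀ ≟ y) (F y))) ⟩
    F f₀ * (∏[ i ∈ allFin n ] unless (earlier? f′ i) (unless (f₀ ≟ f′ i) (F (f′ i))))
      ≡⟨ cong₂ _*_ (sym first) (∏-cong (allFin n) (λ i →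
           unless-⊎ (earlier? f′ i) (f₀ ≟ f′ i) (earlier? f (Fin.suc i)) (F (f′ i))
             shift unshift)) ⟩
    unless (earlier? f Fin.zero) (F f₀) *
      (∏[ i ∈ allFin n ] unless (earlier? f (Fin.suc i)) (F (f′ i)))
      ≡⟨ ∏-allFin-suc n (λ i → unless (earlier? f i) (F (f i))) ⟨
    ∏[ i ∈ allFin (suc n) ] unless (earlier? f i) (F (f i)) ∎
    where
    open ≡-Reasoning

    f₀ = f Fin.zero
    f′ = f ∘ Fin.suc

    first : unless (earlier? f Fin.zero) (F f₀) ≡ F f₀
    first with earlier? f Fin.zero
    ... | no _ = refl

    shift : ∀ {i} → (∃ λ j → j Fin.< i × f′ j ≡ f′ i) ⊎ f₀ ≡ f′ i →
            ∃ λ j → j Fin.< Fin.suc i × f j ≡ f′ i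
    shift (inj₁ (j , j<i , eq)) = Fin.suc j , s≤s j<i , eq
    shift (inj₂ eq)             = Fin.zero , s≤s z≤n , eq

    unshift : ∀ {i} → (∃ λ j → j Fin.< Fin.suc i × f j ≡ f′ i) →
              (∃ λ j → j Fin.< i × f′ j ≡ f′ i) ⊎ f₀ ≡ f′ i
    unshift (Fin.zero  , _       , eq) = inj₂ eq
    unshift (Fin.suc j , s≤s j<i , eq) = inj₁ (j , j<i , eq)

-- Counting colours in an interval

∑-upTo-suc : ∀ m (f : ℕ → ℤ) → ∑ (upTo (suc m)) f ≡ f 0 + ∑ (upTo m) (f ∘ suc)
∑-upTo-suc m f = cong (ℤ._+_ (f 0))
  (trans (cong (λ cs → ∑ cs f) (sym (List.map-upTo suc m))) (∑-map suc (upTo m) f))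

-- For the colour `c + 1` of `[m]`: at least `q` colours lie below it and at least `r` above.
interval? : ∀ m q r c → Dec (q ℕ.≤ c × c ℕ.+ r ℕ.< m)
interval? m q r c = (q ℕ.≤? c) ×-dec (c ℕ.+ r ℕ.<? m)

-- Removing `c = 0` lowers `m` by one. For positive `q` that value is excluded and `q` drops too;
-- for `q = 0` it counts exactly when `r ≤ m`, which is where truncated subtraction sets in.
∑-interval : ∀ m q r → ∑[ c ∈ upTo m ] 𝟙 (interval? m q r c) ≡ + (m ∸ (q ℕ.+ r))
∑-interval zero    q       r = cong +_ (sym (ℕ.0∸n≡0 (q ℕ.+ r)))
∑-interval (suc m) (suc q) r = begin
  ∑[ c ∈ upTo (suc m) ] 𝟙 (interval? (suc m) (suc q) r c)
    ≡⟨ ∑-upTo-suc m (𝟙 ∘ interval? (suc m) (suc q) r) ⟩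
  𝟙 (interval? (suc m) (suc q) r 0) + (∑[ c ∈ upTo m ] 𝟙 (interval? (suc m) (suc q) r (suc c)))
    ≡⟨ cong₂ _+_ (𝟙-no (interval? (suc m) (suc q) r 0) λ { (() , _) })
         (∑-cong (upTo m) (λ c _ → 𝟙-cong (interval? (suc m) (suc q) r (suc c)) (interval? m q r c)
           (λ { (s≤s a , s≤s b) → a , b }) (λ (a , b) → s≤s a , s≤s b))) ⟩
  0ℤ + (∑[ c ∈ upTo m ] 𝟙 (interval? m q r c))
    ≡⟨ ℤ.+-identityˡ _ ⟩
  ∑[ c ∈ upTo m ] 𝟙 (interval? m q r c)
    ≡⟨ ∑-interval m q r ⟩
  + (m ∸ (q ℕ.+ r)) ∎
  where open ≡-Reasoning
∑-interval (suc m) zero r = begin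
  ∑[ c ∈ upTo (suc m) ] 𝟙 (interval? (suc m) 0 r c)
    ≡⟨ ∑-upTo-suc m (𝟙 ∘ interval? (suc m) 0 r) ⟩
  𝟙 (interval? (suc m) 0 r 0) + (∑[ c ∈ upTo m ] 𝟙 (interval? (suc m) 0 r (suc c)))
    ≡⟨ cong (ℤ._+_ (𝟙 (interval? (suc m) 0 r 0)))
         (∑-cong (upTo m) (λ c _ → 𝟙-cong (interval? (suc m) 0 r (suc c)) (interval? m 0 r c)
           (λ { (_ , s≤s b) → z≤n , b }) (λ (_ , b) → z≤n , s≤s b))) ⟩
  𝟙 (interval? (suc m) 0 r 0) + (∑[ c ∈ upTo m ] 𝟙 (interval? m 0 r c))
    ≡⟨ cong (ℤ._+_ (𝟙 (interval? (suc m) 0 r 0))) (∑-interval m 0 r) ⟩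
  𝟙 (interval? (suc m) 0 r 0) + + (m ∸ r)
    ≡⟨ first (r ℕ.≤? m) ⟩
  + (suc m ∸ r) ∎
  where
  open ≡-Reasoning
  first : Dec (r ℕ.≤ m) → 𝟙 (interval? (suc m) 0 r 0) + + (m ∸ r) ≡ + (suc m ∸ r)
  first (yes r≤m) = trans (cong (_+ + (m ∸ r)) (𝟙-yes (interval? (suc m) 0 r 0) (z≤n , s≤s r≤m)))
                          (cong +_ (sym (ℕ.+-∸-assoc 1 r≤m)))
  first (no r≰m)  = cong₂ (λ a b → a + + b)
    (𝟙-no (interval? (suc m) 0 r 0) (λ { (_ , s≤s r≤m) → r≰m r≤m }))
    (trans (ℕ.m≤n⇒m∸n≡0 (ℕ.<⇒≤ (ℕ.≰⇒> r≰m))) (sym (ℕ.m≤n⇒m∸n≡0 (ℕ.≰⇒> r≰m))))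

⁺-∸ : ∀ m h → (+ m - + h) ⁺ ≡ + (m ∸ h)
⁺-∸ m h with ℕ.≤-total h m
... | inj₁ h≤m = trans (cong _⁺ (trans (ℤ.m-n≡m⊖n m h) (ℤ.⊖-≥ h≤m))) (ℤ.i≥j⇒i⊔j≡i (ℤ.+≤+ z≤n))
... | inj₂ m≤h = trans
  (ℤ.i≤j⇒i⊔j≡j (ℤ.≤-trans (ℤ.≤-reflexive (trans (ℤ.m-n≡m⊖n m h) (ℤ.⊖-≤ m≤h)))
                             (ℤ.neg-mono-≤ (ℤ.+≤+ z≤n))))
  (cong +_ (sym (ℕ.m≤n⇒m∸n≡0 m≤h)))

colours : ℕ → List ℤ
colours m = map (λ c → + suc c) (upTo m)

colours-unique : ∀ m → Unique (colours m)
colours-unique m = Unique.map⁺ (ℕ.suc-injective ∘ ℤ.+-injective) (Unique.upTo⁺ m)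

InRange : ℕ → ℤ → Set
InRange m a = 1ℤ ℤ.≤ a × a ℤ.≤ + m

inRange? : ∀ m → Decidable (InRange m)
inRange? m a = (1ℤ ℤ.≤? a) ×-dec (a ℤ.≤? + m)

∈-colours : ∀ {m a} → a L.∈ colours m ⇔ InRange m a
∈-colours {m} = mk⇔ ∈⇒ ⇒∈
  where
  ∈⇒ : ∀ {a} → a L.∈ colours m → InRange m a
  ∈⇒ a∈ with c , c∈ , refl ← ∈-map⁻ (λ c → + suc c) a∈ = ℤ.+≤+ (s≤s z≤n) , ℤ.+≤+ (∈-upTo⁻ c∈)
  ⇒∈ : ∀ {a} → InRange m a → a L.∈ colours m
  ⇒∈ {+ suc c} (_ , ℤ.+≤+ c<m) = ∈-map⁺ (λ c → + suc c) (∈-upTo⁺ c<m)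
  ⇒∈ {+ zero}  (ℤ.+≤+ () , _)

foldr-⊔-upper : ∀ {g} e xs → g L.∈ xs → g ℤ.≤ foldr _⊔_ e xs
foldr-⊔-upper e (x ∷ xs) (here refl) = ℤ.i≤i⊔j _ _
foldr-⊔-upper e (x ∷ xs) (there g∈)  = ℤ.≤-trans (foldr-⊔-upper e xs g∈) (ℤ.i≤j⊔i _ _)

-- Improper edges

module _ (G : GainGraph n) where
  open GainGraph G

  improper? : ∀ x e → Dec (lookup x (tgt e) ≡ lookup x (src e) + gain e)
  improper? x e = lookup x (tgt e) ℤ.≟ lookup x (src e) + gain e

  improper : Vec ℤ n → EdgeSet G
  improper x = Vec.tabulate (does ∘ improper? x)

  module _ (x : Vec ℤ n) where

    improper-dart⁻ : ∀ d → edge G d ∈ improper x → lookup x (head G d) ≡ lookup x (tail G d) + φ G d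
    improper-dart⁻ (e , Sign.+) e∈ = ∈-tabulate-does⁻ (improper? x) e∈
    improper-dart⁻ (e , Sign.-) e∈ = begin
      lookup x (src e)
        ≡⟨ lemma (lookup x (src e)) (gain e) ⟩
      lookup x (src e) + gain e + - gain e
        ≡⟨ cong (_+ - gain e) (∈-tabulate-does⁻ (improper? x) e∈) ⟨
      lookup x (tgt e) + - gain e ∎
      where
      open ≡-Reasoning
      lemma : ∀ a b → a ≡ a + b + - b
      lemma = ℤ-Solver.solve-∀

    improper-dart⁺ : ∀ d → lookup x (head G d) ≡ lookup x (tail G d) + φ G d → edge G d ∈ improper x
    improper-dart⁺ (e , Sign.+) eq = ∈-tabulate-does⁺ (improper? x) eq
    improper-dart⁺ (e , Sign.-) eq = ∈-tabulate-does⁺ (improper? x) (begin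
      lookup x (tgt e)
        ≡⟨ lemma (lookup x (tgt e)) (gain e) ⟩
      lookup x (tgt e) + - gain e + gain e
        ≡⟨ cong (_+ gain e) eq ⟨
      lookup x (src e) + gain e ∎)
      where
      open ≡-Reasoning
      lemma : ∀ a b → a ≡ a + - b + b
      lemma = ℤ-Solver.solve-∀

    -- On improper edges the gain is the difference of `x` at the two ends, so gains telescope. Both
    -- balance and closedness of `improper x` come from this.
    improper-walk : ∀ {u v} ds → Walk G (improper x) u ds v →
                    lookup x v ≡ lookup x u + totalGain G ds
    improper-walk []       (refl , [])               = sym (ℤ.+-identityʳ _)
    improper-walk (d ∷ ds) ((refl , wk) , e∈ ∷ in-B) =
      trans (improper-walk ds (wk , in-B))
        (trans (cong (_+ totalGain G ds) (improper-dart⁻ d e∈))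
               (ℤ.+-assoc (lookup x (tail G d)) (φ G d) (totalGain G ds)))

    improper-balanced : Balanced G (improper x)
    improper-balanced X C _ C⊆ v ds (wk , _ , C≡) =
      identityʳ-unique (lookup x v) (totalGain G ds) (sym (improper-walk ds
        (wk , All.tabulate (λ {d} d∈ → C⊆ (from (C≡ (edge G d)) (∈-map⁺ (edge G) d∈))))))

    improper-closed : Closed G (improper x)
    improper-closed d ds p eq = improper-dart⁺ d
      (trans (improper-walk ds (path⇒walk G p)) (cong (ℤ._+_ (lookup x (tail G d))) eq))

-- Heights

module _ (G : GainGraph n) (B : EdgeSet G) where

  ∈-component : ∀ {u v} → v ∈ component G B u ⇔ Joined G B u v
  ∈-component {u} = mk⇔ (∈-tabulate-does⁻ (joined? G B u)) (∈-tabulate-does⁺ (joined? G B u))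

  component≡⇒joined : ∀ {u v} → component G B u ≡ component G B v → Joined G B u v
  component≡⇒joined {u} {v} eq =
    to ∈-component (subst (v ∈_) (sym eq) (from ∈-component (joined-refl G)))

  joined⇒component≡ : ∀ {u v} → Joined G B u v → component G B u ≡ component G B v
  joined⇒component≡ j = Sub.⊆-antisym
    (λ w∈ → from ∈-component (joined-trans G (joined-sym G j) (to ∈-component w∈)))
    (λ w∈ → from ∈-component (joined-trans G j (to ∈-component w∈)))

  ∈-pathGains⁺ : ∀ {W u v} ds → IsPath G B u ds v → All (_∈ W) (vertices G u ds) →
                 totalGain G ds L.∈ pathGains G B W
  ∈-pathGains⁺ {W} {u} {v} ds p in-W =
    ∈-map⁺ (λ (_ , ds , _) → totalGain G ds) {x = u , ds , v}
      (∈-filter⁺ _ (∈-cartesianProduct⁺ (∈-allFin u) (∈-cartesianProduct⁺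
        (∈-listsUpTo (∈-darts G) ds (path-length≤ G B u ds v p)) (∈-allFin v))) (p , in-W))

  ∈-pathGains⁻ : ∀ {W g} → g L.∈ pathGains G B W →
    ∃₂ λ u v → ∃ λ ds → IsPath G B u ds v × All (_∈ W) (vertices G u ds) × g ≡ totalGain G ds
  ∈-pathGains⁻ {W} g∈
    with (u , ds , v) , t∈ , g≡ ← ∈-map⁻ (λ (_ , ds , _) → totalGain G ds) g∈
    with _ , p , in-W ← ∈-filter⁻
           (λ (u , ds , v) → isPath? G B u ds v ×-dec All.all? (_∈? W) (vertices G u ds))
           {xs = cartesianProduct (allFin n) (cartesianProduct (listsUpTo (darts G) n) (allFin n))}
           t∈ =
    u , v , ds , p , in-W , g≡

  -- By balance any path from `s` to `t` has this gain, and all its vertices stay in the component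
  -- of `i`, so the gain is among those maximised.
  height-upper : Balanced G B → ∀ {i s t} → Joined G B i s → Joined G B i t →
                 gainBetween G B s t ℤ.≤ height G B (component G B i)
  height-upper bal {i} {s} {t} i∼s i∼t = go (joined-trans G (joined-sym G i∼s) i∼t)
    where
    go : Joined G B s t → gainBetween G B s t ℤ.≤ height G B (component G B i)
    go (ds , p) = ℤ.≤-trans (ℤ.≤-reflexive (gainBetween-walk G bal ds (path⇒walk G p)))
      (foldr-⊔-upper 0ℤ (pathGains G B (component G B i)) (∈-pathGains⁺ ds p
        (All.tabulate (λ w∈ → from ∈-component (joined-trans G i∼s (vertices-joined G ds p w∈))))))

  height-attained : Balanced G B → ∀ i →
    ∃₂ λ s t → Joined G B i s × Joined G B i t × gainBetween G B s t ≡ height G B (component G B i)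
  height-attained bal i = go (foldr-selective ℤ.⊔-sel 0ℤ (pathGains G B (component G B i)))
    where
    go : ∀ {h} → h ≡ 0ℤ ⊎ h L.∈ pathGains G B (component G B i) →
         ∃₂ λ s t → Joined G B i s × Joined G B i t × gainBetween G B s t ≡ h
    -- The starting value 0 of the fold is realised by the empty path at `i`.
    go (inj₁ h≡0) = i , i , joined-refl G , joined-refl G ,
                    trans (gainBetween-refl G bal i) (sym h≡0)
    go (inj₂ h∈)  = path (∈-pathGains⁻ h∈)
      where
      path : (∃₂ λ u v → ∃ λ ds → IsPath G B u ds v ×
               All (_∈ component G B i) (vertices G u ds) × _ ≡ totalGain G ds) → _
      path (u , v , ds , p , in-W , h≡) =
        u , v , to ∈-component (All.lookup in-W (here refl)) ,
        to ∈-component (All.lookup in-W (end∈vertices G ds (proj₁ p))) ,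
        trans (gainBetween-walk G bal ds (path⇒walk G p)) (sym h≡)

+-cancelˡ-≤ : ∀ a {b c} → a + b ℤ.≤ a + c → b ℤ.≤ c
+-cancelˡ-≤ a {b} {c} le =
  subst (ℤ._≤ c) (sym (lemma a b))
    (subst (- a + (a + b) ℤ.≤_) (sym (lemma a c)) (ℤ.+-monoʳ-≤ (- a) le))
  where
  lemma : ∀ a b → b ≡ - a + (a + b)
  lemma = ℤ-Solver.solve-∀

-- Points at which a balanced edge set is improper

module _ (G : GainGraph n) (B : EdgeSet G) (bal : Balanced G B) (m : ℕ) where
  open GainGraph G

  private
    _∼_ : Fin n → Fin n → Set
    _∼_ = Joined G B

    δ : Fin n → Fin n → ℤ
    δ = gainBetween G B

    δ-trans : ∀ {u v w} → u ∼ v → v ∼ w → δ u v + δ v w ≡ δ u w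
    δ-trans = gainBetween-trans G bal

    h : Fin n → ℤ
    h i = height G B (component G B i)

  -- Colour `a` at `i` dictates `a + δ i v` at every `v` of the component. All these values are
  -- tested, also at vertices not yet reached, so that no forced value can later leave `[m]`.
  Fits : Fin n → ℤ → Set
  Fits i a = ∀ v → i ∼ v → InRange m (a + δ i v)

  fits? : ∀ i a → Dec (Fits i a)
  fits? i a = Fin.all? (λ v → joined? G B i v →-dec inRange? m (a + δ i v))

  ∑-fits : ∀ i → ∑[ a ∈ colours m ] 𝟙 (fits? i a) ≡ (+ m - h i) ⁺
  ∑-fits i = go (height-attained G B bal i)
    where
    -- The colours a + δ i v of the component of i range from a − q to a + r.
    go : (∃₂ λ s t → i ∼ s × i ∼ t × δ s t ≡ h i) → _
    go (s , t , i∼s , i∼t , δst≡h) = begin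
      ∑[ a ∈ colours m ] 𝟙 (fits? i a)
        ≡⟨ ∑-map (λ c → + suc c) (upTo m) (𝟙 ∘ fits? i) ⟩
      ∑[ c ∈ upTo m ] 𝟙 (fits? i (+ suc c))
        ≡⟨ ∑-cong (upTo m) (λ c _ → 𝟙-cong (fits? i (+ suc c)) (interval? m q r c)
             (fits⇒ c) (⇒fits c)) ⟩
      ∑[ c ∈ upTo m ] 𝟙 (interval? m q r c)
        ≡⟨ ∑-interval m q r ⟩
      + (m ∸ (q ℕ.+ r))
        ≡⟨ ⁺-∸ m (q ℕ.+ r) ⟨
      (+ m - + (q ℕ.+ r)) ⁺
        ≡⟨ cong (λ z → (+ m - z) ⁺) q+r≡h ⟩
      (+ m - h i) ⁺ ∎
      where
      open ≡-Reasoning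

      s∼i = joined-sym G i∼s
      s∼t = joined-trans G s∼i i∼t

      -- Were the gain from `s` to `v` negative, the gain from `v` to `t` would exceed the maximum
      -- `δ s t`.
      0≤δ-from-s : ∀ {v} → i ∼ v → 0ℤ ℤ.≤ δ s v
      0≤δ-from-s {v} i∼v = +-cancelˡ-≤ (δ v t) (ℤ.≤-trans
        (ℤ.≤-reflexive (ℤ.+-identityʳ (δ v t)))
        (ℤ.≤-trans (height-upper G B bal i∼v i∼t) (ℤ.≤-reflexive (trans (sym δst≡h)
          (trans (sym (δ-trans (joined-trans G s∼i i∼v) (joined-trans G (joined-sym G i∼v) i∼t)))
                 (ℤ.+-comm (δ s v) (δ v t)))))))

      -- Likewise, a gain from `i` above `δ i t` would, when started at `s`, exceed the maximum.
      δ≤δit : ∀ {v} → i ∼ v → δ i v ℤ.≤ δ i t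
      δ≤δit {v} i∼v = +-cancelˡ-≤ (δ s i) (ℤ.≤-trans
        (ℤ.≤-reflexive (δ-trans s∼i i∼v))
        (ℤ.≤-trans (height-upper G B bal i∼s i∼v)
          (ℤ.≤-reflexive (trans (sym δst≡h) (sym (δ-trans s∼i i∼t))))))

      q r : ℕ
      q = ℤ.∣ δ s i ∣
      r = ℤ.∣ δ i t ∣

      q≡ : + q ≡ δ s i
      q≡ = ℤ.0≤i⇒+∣i∣≡i (0≤δ-from-s (joined-refl G))

      r≡ : + r ≡ δ i t
      r≡ = ℤ.0≤i⇒+∣i∣≡i (subst (ℤ._≤ δ i t) (gainBetween-refl G bal i) (δ≤δit (joined-refl G)))

      q+r≡h : + (q ℕ.+ r) ≡ h i
      q+r≡h = trans (cong₂ _+_ q≡ r≡) (trans (δ-trans s∼i i∼t) δst≡h)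

      q+δis≡0 : + q + δ i s ≡ 0ℤ
      q+δis≡0 = trans (cong (_+ δ i s) q≡) (trans (δ-trans s∼i i∼s) (gainBetween-refl G bal s))

      fits⇒ : ∀ c → Fits i (+ suc c) → q ℕ.≤ c × c ℕ.+ r ℕ.< m
      fits⇒ c fits = ℕ.≤-pred (ℤ.drop‿+≤+ q<) , ℤ.drop‿+≤+ r<
        where
        rearrange : ∀ q a d → q + (a + d) ≡ a + (q + d)
        rearrange = ℤ-Solver.solve-∀

        -- The colour at `s` is `c + 1 - q`; that it is at least 1 means `q ≤ c`.
        q< : + suc q ℤ.≤ + suc c
        q< = ℤ.≤-trans (ℤ.≤-reflexive (ℤ.+-comm 1ℤ (+ q)))
          (ℤ.≤-trans (ℤ.+-monoʳ-≤ (+ q) (proj₁ (fits s i∼s)))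
            (ℤ.≤-reflexive (trans (rearrange (+ q) (+ suc c) (δ i s))
              (trans (cong (ℤ._+_ (+ suc c)) q+δis≡0) (ℤ.+-identityʳ (+ suc c))))))

        r< : + (suc c ℕ.+ r) ℤ.≤ + m
        r< = ℤ.≤-trans (ℤ.≤-reflexive (cong (ℤ._+_ (+ suc c)) r≡)) (proj₂ (fits t i∼t))

      ⇒fits : ∀ c → q ℕ.≤ c × c ℕ.+ r ℕ.< m → Fits i (+ suc c)
      ⇒fits c (q≤c , r<) v i∼v = lower , upper
        where
        0≤q+δ : 0ℤ ℤ.≤ + q + δ i v
        0≤q+δ = ℤ.≤-trans (0≤δ-from-s i∼v)
          (ℤ.≤-reflexive (trans (sym (δ-trans s∼i i∼v)) (cong (_+ δ i v) (sym q≡))))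

        lower : 1ℤ ℤ.≤ + suc c + δ i v
        lower = ℤ.≤-trans (ℤ.+-monoʳ-≤ 1ℤ 0≤q+δ)
          (ℤ.≤-trans (ℤ.≤-reflexive (sym (ℤ.+-assoc 1ℤ (+ q) (δ i v))))
            (ℤ.+-monoˡ-≤ (δ i v) (ℤ.+≤+ (s≤s q≤c))))

        upper : + suc c + δ i v ℤ.≤ + m
        upper = ℤ.≤-trans (ℤ.+-monoʳ-≤ (+ suc c) (δ≤δit i∼v))
          (ℤ.≤-trans (ℤ.≤-reflexive (cong (ℤ._+_ (+ suc c)) (sym r≡))) (ℤ.+≤+ r<))

  -- The values allowed at i once the coordinates before i are fixed: the first
  -- vertex of a component is free within the range, the others are forced.
  Allowed : Fin n → Vec ℤ n → ℤ → Set
  Allowed i x a = (∀ j → j Fin.< i → j ∼ i → a ≡ lookup x j + δ j i) × Fits i a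

  allowed? : ∀ i x a → Dec (Allowed i x a)
  allowed? i x a =
    Fin.all? (λ j → (j Fin.<? i) →-dec (joined? G B j i →-dec (a ℤ.≟ lookup x j + δ j i)))
    ×-dec fits? i a

  allowed-local : ∀ i {x y a} → (∀ j → j Fin.< i → lookup x j ≡ lookup y j) →
                  Allowed i x a → Allowed i y a
  allowed-local i agree (forced , fits) =
    (λ j j<i j∼i → trans (forced j j<i j∼i) (cong (_+ δ j i) (agree j j<i))) , fits

  choices : Fin n → ℤ
  choices i = unless (earlier? _≟ₛ_ (component G B) i) ((+ m - h i) ⁺)

  -- At the first vertex of a component the forcing condition is vacuous and `∑-fits` counts.
  -- Otherwise an earlier vertex `j` of the component leaves only `b`; it agrees with the other
  -- earlier vertices because gains add up, and lies in range because `Fits` already holds at `j`.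
  ∑-allowed : ∀ i x → (∀ j → j Fin.< i → Allowed j x (lookup x j)) →
              ∑[ a ∈ colours m ] 𝟙 (allowed? i x a) ≡ choices i
  ∑-allowed i x before = go (earlier? _≟ₛ_ (component G B) i)
    where
    open ≡-Reasoning

    go : (e? : Dec (∃ λ j → j Fin.< i × component G B j ≡ component G B i)) →
         ∑[ a ∈ colours m ] 𝟙 (allowed? i x a) ≡ unless e? ((+ m - h i) ⁺)
    go (no first) = trans
      (∑-cong (colours m) (λ a _ → 𝟙-cong (allowed? i x a) (fits? i a) proj₂
        (λ fits → (λ j j<i j∼i →
          contradiction (j , j<i , joined⇒component≡ G B j∼i) first) , fits)))
      (∑-fits i)
    go (yes (j , j<i , j≡i)) = begin
      ∑[ a ∈ colours m ] 𝟙 (allowed? i x a)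
        ≡⟨ ∑-cong (colours m) (λ a _ → trans
             (𝟙-cong (allowed? i x a) (a ℤ.≟ b) (λ (forced , _) → forced j j<i j∼i)
               (λ { refl → b-allowed }))
             (sym (ℤ.*-identityˡ _))) ⟩
      ∑[ a ∈ colours m ] 1ℤ * 𝟙 (a ℤ.≟ b)
        ≡⟨ ∑-𝟙≡ ℤ._≟_ (colours m) (colours-unique m) b
             (from ∈-colours (proj₂ (before j j<i) i j∼i)) (λ _ → 1ℤ) ⟩
      1ℤ ∎
      where
      j∼i : j ∼ i
      j∼i = component≡⇒joined G B j≡i

      b : ℤ
      b = lookup x j + δ j i

      -- Of two earlier vertices the later one was itself forced by the other, so both prescribe the
      -- same value at `w`.
      via : ∀ {u v w} → u Fin.< i → v Fin.< i → u Fin.< v → u ∼ v → v ∼ w →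
            lookup x v + δ v w ≡ lookup x u + δ u w
      via {u} {v} {w} u<i v<i u<v u∼v v∼w = begin
        lookup x v + δ v w
          ≡⟨ cong (_+ δ v w) (proj₁ (before v v<i) u u<v u∼v) ⟩
        lookup x u + δ u v + δ v w
          ≡⟨ ℤ.+-assoc (lookup x u) (δ u v) (δ v w) ⟩
        lookup x u + (δ u v + δ v w)
          ≡⟨ cong (ℤ._+_ (lookup x u)) (δ-trans u∼v v∼w) ⟩
        lookup x u + δ u w ∎

      consistent : ∀ k → k Fin.< i → k ∼ i → b ≡ lookup x k + δ k i
      consistent k k<i k∼i with Fin.<-cmp j k
      ... | tri< j<k _ _    = sym (via j<i k<i j<k (joined-trans G j∼i (joined-sym G k∼i)) k∼i)
      ... | tri≈ _ refl _   = refl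
      ... | tri> _ _ k<j    = via k<i j<i k<j (joined-trans G k∼i (joined-sym G j∼i)) j∼i

      b-fits : Fits i b
      b-fits v i∼v = subst (InRange m) (begin
        lookup x j + δ j v
          ≡⟨ cong (ℤ._+_ (lookup x j)) (δ-trans j∼i i∼v) ⟨
        lookup x j + (δ j i + δ i v)
          ≡⟨ ℤ.+-assoc (lookup x j) (δ j i) (δ i v) ⟨
        b + δ i v ∎) (proj₂ (before j j<i) v (joined-trans G j∼i i∼v))

      b-allowed : Allowed i x b
      b-allowed = consistent , b-fits

  -- Forward, `x` changes along a path by its gain. Backward, the endpoint of an edge with the
  -- larger index is forced by the other endpoint, through the path consisting of that edge.
  improper⇔allowed : ∀ x → (∀ v → InRange m (lookup x v)) →
                     B ⊆ improper G x ⇔ (∀ i → Allowed i x (lookup x i))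
  improper⇔allowed x inRange = mk⇔ ⊆⇒ ⇒⊆
    where
    ⊆⇒ : B ⊆ improper G x → ∀ i → Allowed i x (lookup x i)
    ⊆⇒ B⊆ i = (λ j _ j∼i → along j∼i) , λ v i∼v → subst (InRange m) (along i∼v) (inRange v)
      where
      along : ∀ {u v} → u ∼ v → lookup x v ≡ lookup x u + δ u v
      along {u} {v} (ds , p) = trans
        (improper-walk G x ds (proj₁ p , All.map B⊆ (proj₁ (proj₂ p))))
        (cong (ℤ._+_ (lookup x u)) (sym (gainBetween-walk G bal ds (path⇒walk G p))))

    ⇒⊆ : (∀ i → Allowed i x (lookup x i)) → B ⊆ improper G x
    ⇒⊆ allowed {e} e∈ = go (Fin.<-cmp (src e) (tgt e))
      where
      forward : Walk G B (src e) [ e , Sign.+ ] (tgt e)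
      forward = (refl , refl) , e∈ ∷ []

      backward : Walk G B (tgt e) [ e , Sign.- ] (src e)
      backward = (refl , refl) , e∈ ∷ []

      go : _ → e ∈ improper G x
      go (tri< u<v _ _) = improper-dart⁺ G x (e , Sign.+)
        (trans (proj₁ (allowed (tgt e)) (src e) u<v (walk⇒joined G _ forward))
          (cong (ℤ._+_ (lookup x (src e)))
            (trans (gainBetween-walk G bal _ forward) (ℤ.+-identityʳ _))))
      go (tri> _ _ v<u) = improper-dart⁺ G x (e , Sign.-)
        (trans (proj₁ (allowed (src e)) (tgt e) v<u (walk⇒joined G _ backward))
          (cong (ℤ._+_ (lookup x (tgt e)))
            (trans (gainBetween-walk G bal _ backward) (ℤ.+-identityʳ _))))
      -- A loop forces nothing; the required equation says that its gain is 0, which is balance.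
      go (tri≈ _ u≡v _) = improper-dart⁺ G x (e , Sign.+) (trans (cong (lookup x) (sym u≡v))
        (trans (sym (ℤ.+-identityʳ _)) (cong (ℤ._+_ (lookup x (src e))) (sym
          (trans (sym (ℤ.+-identityʳ _)) (balanced⇒closedWalk-neutral G bal [ e , Sign.+ ]
            ((refl , sym u≡v) , e∈ ∷ [])))))))

  ∑-improper : ∑[ x ∈ vectors (colours m) n ] 𝟙 (B ⊆? improper G x) ≡
               ∏[ W ∈ π G B ] ((+ m - height G B W) ⁺)
  ∑-improper = begin
    ∑[ x ∈ vectors (colours m) n ] 𝟙 (B ⊆? improper G x)
      ≡⟨ ∑-cong (vectors (colours m) n) (λ x x∈ → 𝟙-cong (B ⊆? improper G x)
           (Fin.all? (λ i → allowed? i x (lookup x i)))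
           (to (improper⇔allowed x (λ v → to ∈-colours (∈-vectors⁻ n x∈ v))))
           (from (improper⇔allowed x (λ v → to ∈-colours (∈-vectors⁻ n x∈ v))))) ⟩
    ∑[ x ∈ vectors (colours m) n ] 𝟙 (Fin.all? (λ i → allowed? i x (lookup x i)))
      ≡⟨ ∑-triangular 0ℤ (colours m) n Allowed allowed? choices allowed-local ∑-allowed ⟩
    ∏ (allFin n) choices
      ≡⟨ ∏-deduplicate _≟ₛ_ n (component G B) (λ W → (+ m - height G B W) ⁺) ⟨
    ∏[ W ∈ π G B ] ((+ m - height G B W) ⁺) ∎
    where open ≡-Reasoning

-- Integer points as colorations

∑-vectors-map : ∀ (f : A → A′) xs n F →
                ∑ (vectors (map f xs) n) F ≡ ∑ (vectors xs n) (F ∘ Vec.map f)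
∑-vectors-map f xs zero    F = refl
∑-vectors-map f xs (suc n) F = begin
  ∑ (vectors (map f xs) (suc n)) F
    ≡⟨ ∑-vectors (map f xs) n F ⟩
  ∑[ b ∈ map f xs ] ∑[ v ∈ vectors (map f xs) n ] F (b ∷ v)
    ≡⟨ ∑-map f xs (λ b → ∑[ v ∈ vectors (map f xs) n ] F (b ∷ v)) ⟩
  ∑[ a ∈ xs ] ∑[ v ∈ vectors (map f xs) n ] F (f a ∷ v)
    ≡⟨ ∑-cong xs (λ a _ → ∑-vectors-map f xs n (λ v → F (f a ∷ v))) ⟩
  ∑[ a ∈ xs ] ∑[ v ∈ vectors xs n ] F (Vec.map f (a ∷ v))
    ≡⟨ ∑-vectors xs n (F ∘ Vec.map f) ⟨
  ∑ (vectors xs (suc n)) (F ∘ Vec.map f) ∎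
  where open ≡-Reasoning

applyUpTo≡tabulate : ∀ (f : ℕ → A) m → List.applyUpTo f m ≡ List.tabulate {n = m} (f ∘ toℕ)
applyUpTo≡tabulate f zero    = refl
applyUpTo≡tabulate f (suc m) = cong (f 0 ∷_) (applyUpTo≡tabulate (f ∘ suc) m)

toColour : Fin m → ℤ
toColour c = + suc (toℕ c)

colours≡map-toColour : ∀ m → colours m ≡ map toColour (allFin m)
colours≡map-toColour m = begin
  map (λ c → + suc c) (upTo m)
    ≡⟨ List.map-upTo (λ c → + suc c) m ⟩
  List.applyUpTo (λ c → + suc c) m
    ≡⟨ applyUpTo≡tabulate (λ c → + suc c) m ⟩
  List.tabulate {n = m} toColour
    ≡⟨ List.map-tabulate {n = m} id toColour ⟨
  map toColour (allFin m) ∎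
  where open ≡-Reasoning

-- The arrangement and its gain graph

module _ (𝒜 : Arrangement n) where
  open Arrangement 𝒜

  ∈ₕ⇔improper : ∀ x p → x ∈ₕ hyperplane p ⇔ p ∈ improper (Φ 𝒜) x
  ∈ₕ⇔improper x p = mk⇔
    (λ eq → improper-dart⁺ (Φ 𝒜) x (p , Sign.+) (trans (restore xⱼ xᵢ) (cong (ℤ._+_ xᵢ) eq)))
    (λ p∈ → trans (cong (_- xᵢ) (improper-dart⁻ (Φ 𝒜) x (p , Sign.+) p∈)) (cancel xᵢ g))
    where
    open Hyperplane (hyperplane p)
    xᵢ xⱼ : ℤ
    xᵢ = lookup x i
    xⱼ = lookup x j
    restore : ∀ a b → a ≡ b + (a - b)
    restore = ℤ-Solver.solve-∀
    cancel : ∀ a b → a + b - a ≡ b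
    cancel = ℤ-Solver.solve-∀

  avoids⇔improper≡⊥ : ∀ x → Avoids 𝒜 x ⇔ ⊥ ≡ improper (Φ 𝒜) x
  avoids⇔improper≡⊥ x = mk⇔
    (λ avoids → sym (Sub.Empty-unique (λ (p , p∈) → avoids p (from (∈ₕ⇔improper x p) p∈))))
    (λ eq p x∈ → Sub.∉⊥ (subst (p ∈_) (sym eq) (to (∈ₕ⇔improper x p) x∈)))

  -- Properness is asked of every dart, avoidance once for each hyperplane; the two orientations of
  -- an edge express the same equation.
  avoids⇔proper : (x : Vec (Fin m) n) → Avoids 𝒜 (Vec.map toColour x) ⇔ Proper (Φ 𝒜) x
  avoids⇔proper x = mk⇔
    (λ avoids d eq → avoids (proj₁ d) (from (∈ₕ⇔improper y _)
      (improper-dart⁺ (Φ 𝒜) y d (trans (colour≡ (head (Φ 𝒜) d)) (trans eq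
        (cong (_+ φ (Φ 𝒜) d) (sym (colour≡ (tail (Φ 𝒜) d)))))))))
    (λ proper p y∈ → proper (p , Sign.+) (trans (sym (colour≡ _)) (trans
      (improper-dart⁻ (Φ 𝒜) y (p , Sign.+) (to (∈ₕ⇔improper y p) y∈))
      (cong (_+ φ (Φ 𝒜) (p , Sign.+)) (colour≡ _)))))
    where
    y : Vec ℤ n
    y = Vec.map toColour x
    colour≡ : ∀ v → lookup y v ≡ colour (Φ 𝒜) x v
    colour≡ v = Vec.lookup-map v toColour x

  avoidingPoints≡χℤ : ∀ m → avoidingPoints 𝒜 m ≡ χℤ (Φ 𝒜) m
  avoidingPoints≡χℤ m = ℤ.+-injective (begin
    + avoidingPoints 𝒜 m
      ≡⟨ length-filter≡∑ (avoids? 𝒜) (vectors (colours m) n) ⟩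
    ∑[ x ∈ vectors (colours m) n ] 𝟙 (avoids? 𝒜 x)
      ≡⟨ cong (λ cs → ∑[ x ∈ vectors cs n ] 𝟙 (avoids? 𝒜 x)) (colours≡map-toColour m) ⟩
    ∑[ x ∈ vectors (map toColour (allFin m)) n ] 𝟙 (avoids? 𝒜 x)
      ≡⟨ ∑-vectors-map toColour (allFin m) n (𝟙 ∘ avoids? 𝒜) ⟩
    ∑[ x ∈ vectors (allFin m) n ] 𝟙 (avoids? 𝒜 (Vec.map toColour x))
      ≡⟨ ∑-cong (vectors (allFin m) n) (λ x _ →
           𝟙-cong (avoids? 𝒜 (Vec.map toColour x)) (proper? (Φ 𝒜) x)
             (to (avoids⇔proper x)) (from (avoids⇔proper x))) ⟩
    ∑[ x ∈ vectors (allFin m) n ] 𝟙 (proper? (Φ 𝒜) x)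
      ≡⟨ length-filter≡∑ (proper? (Φ 𝒜)) (vectors (allFin m) n) ⟨
    + χℤ (Φ 𝒜) m ∎)
    where open ≡-Reasoning

  avoidingPoints≡∑μ : ∀ m → + avoidingPoints 𝒜 m ≡
    ∑[ B ∈ Latᵇ (Φ 𝒜) ] (μ (Φ 𝒜) ⊥ B * (∏[ W ∈ π (Φ 𝒜) B ] ((+ m - height (Φ 𝒜) B W) ⁺)))
  avoidingPoints≡∑μ m = begin
    + avoidingPoints 𝒜 m
      ≡⟨ length-filter≡∑ (avoids? 𝒜) points ⟩
    ∑[ x ∈ points ] 𝟙 (avoids? 𝒜 x)
      ≡⟨ ∑-cong points (λ x _ → 𝟙-cong (avoids? 𝒜 x) (⊥ ≟ₛ improper G x)
           (to (avoids⇔improper≡⊥ x)) (from (avoids⇔improper≡⊥ x))) ⟩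
    ∑[ x ∈ points ] 𝟙 (⊥ ≟ₛ improper G x)
      ≡⟨ ∑-cong points (λ x _ → sym (∑-μ⊥ G
           (∈-Latᵇ G (improper-balanced G x) (improper-closed G x)))) ⟩
    ∑[ x ∈ points ] ∑[ B ∈ Latᵇ G ] μ G ⊥ B * 𝟙 (B ⊆? improper G x)
      ≡⟨ ∑-swap points (Latᵇ G) (λ x B → μ G ⊥ B * 𝟙 (B ⊆? improper G x)) ⟩
    ∑[ B ∈ Latᵇ G ] ∑[ x ∈ points ] μ G ⊥ B * 𝟙 (B ⊆? improper G x)
      ≡⟨ ∑-cong (Latᵇ G) (λ B B∈ → trans
           (∑-*ˡ points (μ G ⊥ B) (λ x → 𝟙 (B ⊆? improper G x)))
           (cong (μ G ⊥ B *_) (∑-improper G B (Latᵇ-balanced G B∈) m))) ⟩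
    ∑[ B ∈ Latᵇ G ] (μ G ⊥ B * (∏[ W ∈ π G B ] ((+ m - height G B W) ⁺))) ∎
    where
    open ≡-Reasoning
    G : GainGraph n
    G = Φ 𝒜
    points : List (Vec ℤ n)
    points = vectors (colours m) n

theorem4p1 : (n : ℕ) (𝒜 : Arrangement n) (m : ℕ) →
    avoidingPoints 𝒜 m ≡ χℤ (Φ 𝒜) m ×
    + avoidingPoints 𝒜 m ≡
    ∑[ B ∈ Latᵇ (Φ 𝒜) ] (μ (Φ 𝒜) ⊥ B * (∏[ W ∈ π (Φ 𝒜) B ] ((+ m - height (Φ 𝒜) B W) ⁺)))
theorem4p1 n 𝒜 m = avoidingPoints≡χℤ 𝒜 m , avoidingPoints≡∑μ 𝒜 m
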